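{- (Subject reduction.) Let $t_0,t_1$ be lambda-terms, $\Gamma;\Delta$ environments and $A$ a DLAL type. If the judgment $\Gamma;\Delta\vdash t_0:A$ is derivable in DLAL and $t_0\longrightarrow t_1$ (one step of $\beta$-reduction, anywhere in the term), then $\Gamma;\Delta\vdash t_1:A$ is derivable in DLAL.
   Context: Lambda-terms are those of the pure untyped lambda-calculus; $\longrightarrow$ is $\beta$-reduction (closed under contexts). DLAL types: $A,B::=\alpha\mid A\multimap B\mid A\Rightarrow B\mid \S A\mid\forall\alpha.A$. Besides types there are discharged formulas $[A]_\S$ ($A$ a type), a technical device (not meant for final typing judgments) allowed only in environments, to the right of the semicolon; they cannot be abstracted. A judgment is $\Gamma;\Delta\vdash t:A$, where $\Gamma$ assigns types to (non-linear) variables, $\Delta$ assigns types or discharged formulas to (linear) variables; environments are finite and unordered, and a comma denotes union of environments with disjoint sets of variables. $A,B,C,B_i$ below denote types. DLAL typing rules (natural deduction NDLAL): (Id) $\;;x:A\vdash x:A$. ($\multimap$ i) from $\Gamma_1;\Delta_1,x:A\vdash t:B$ infer $\Gamma_1;\Delta_1\vdash\lambda x.t:A\multimap B$. ($\multimap$ e) from $\Gamma_1;\Delta_1\vdash t:A\multimap B$ and $\Gamma_2;\Delta_2\vdash u:A$ infer $\Gamma_1,\Gamma_2;\Delta_1,\Delta_2\vdash(t\,u):B$. ($\Rightarrow$ i) from $\Gamma_1,x:A;\Delta_1\vdash t:B$ infer $\Gamma_1;\Delta_1\vdash\lambda x.t:A\Rightarrow B$. ($\Rightarrow$ e) from $\Gamma_1;\Delta_1\vdash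 t:A\Rightarrow B$ and $;z:C\vdash u:A$ infer $\Gamma_1,z:C;\Delta_1\vdash(t\,u):B$; the right premise may also be $;\vdash u:A$, and then $z:C$ is absent from the conclusion. (Weak) from $\Gamma_1;\Delta_1\vdash t:A$ infer $\Gamma_1,\Gamma_2;\Delta_1,\Delta_2\vdash t:A$. (Cntr) from $x_1:A,x_2:A,\Gamma_1;\Delta_1\vdash t:B$ infer $x:A,\Gamma_1;\Delta_1\vdash t[x/x_1,x/x_2]:B$. ($\S$ i) from $;\Gamma,x_1:B_1,\dots,x_n:B_n\vdash t:A$ (all formulas on the left being types) infer $\Gamma;x_1:[B_1]_\S,\dots,x_n:[B_n]_\S\vdash t:\S A$. ($\S$ e) from $\Gamma_1;\Delta_1\vdash u:\S A$ and $\Gamma_2;x:[A]_\S,\Delta_2\vdash t:B$ infer $\Gamma_1,\Gamma_2;\Delta_1,\Delta_2\vdash t[u/x]:B$. ($\forall$ i) from $\Gamma_1;\Delta_1\vdash t:A$ infer $\Gamma_1;\Delta_1\vdash t:\forall\alpha.A$, provided $\alpha$ is not free in $\Gamma_1,\Delta_1$. ($\forall$ e) from $\Gamma_1;\Delta_1\vdash t:\forall\alpha.A$ infer $\Gamma_1;\Delta_1\vdash t:A[B/\alpha]$. -}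

module Defs where

open import Data.Fin.Base using (Fin; zero; suc)
open import Data.Fin.Substitution using (Lift; Sub; TermSubst; module VarSubst)
open import Data.Nat.Base using (ℕ; suc)
open import Data.Vec.Base using (Vec; []; _∷_; lookup; map; replicate; _[_]≔_)
open import Data.Vec.Relation.Binary.Pointwise.Inductive using (Pointwise)

private
  variable
    k n : ℕ

infixl 9 _·_

data Term (n : ℕ) : Set where
  var : (x : Fin n) → Term n
  ƛ   : (t : Term (suc n)) → Term n
  _·_ : (t u : Term n) → Term n

module TermApp {T : ℕ → Set} (l : Lift T Term) where
  open Lift l hiding (var)

  infixl 8 _/_

  _/_ : ∀ {m n} → Term m → Sub T m n → Term n
  var x   / ρ = lift (lookup ρ x)
  ƛ t     / ρ = ƛ (t / ρ ↑)
  (t · u) / ρ = (t / ρ) · (u / ρ)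

termSubst : TermSubst Term
termSubst = record { var = var; app = TermApp._/_ }

module TermSubstitution = TermSubst termSubst

infix 8 _[_]

_[_] : Term (suc n) → Term n → Term n
t [ u ] = t / sub u
  where open TermSubstitution using (_/_; sub)

-- t[x/x₁, x/x₂], where x₁ and x₂ are the two innermost variables of t.

contract : Fin n → Term (suc (suc n)) → Term n
contract x t = t /Var (x ∷ x ∷ VarSubst.id)
  where open TermSubstitution using (_/Var_)

infix 4 _⟶_

data _⟶_ {n : ℕ} : Term n → Term n → Set where
  β  : ∀ {t u} → ƛ t · u ⟶ t [ u ]
  ξ  : ∀ {t t′} → t ⟶ t′ → ƛ t ⟶ ƛ t′
  ·ˡ : ∀ {t t′ u} → t ⟶ t′ → t · u ⟶ t′ · u
  ·ʳ : ∀ {t u u′} → u ⟶ u′ → t · u ⟶ t · u′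

infixr 6 _⊸_ _⇒_
infix  7 §_

data Type (k : ℕ) : Set where
  var : (α : Fin k) → Type k
  _⊸_ : (A B : Type k) → Type k
  _⇒_ : (A B : Type k) → Type k
  §_  : (A : Type k) → Type k
  ∀′  : (A : Type (suc k)) → Type k

module TypeApp {T : ℕ → Set} (l : Lift T Type) where
  open Lift l hiding (var)

  infixl 8 _/_

  _/_ : ∀ {j k} → Type j → Sub T j k → Type k
  var α   / ρ = lift (lookup ρ α)
  (A ⊸ B) / ρ = (A / ρ) ⊸ (B / ρ)
  (A ⇒ B) / ρ = (A / ρ) ⇒ (B / ρ)
  (§ A)   / ρ = § (A / ρ)
  ∀′ A    / ρ = ∀′ (A / ρ ↑)

typeSubst : TermSubst Type
typeSubst = record { var = var; app = TypeApp._/_ }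

module TypeSubstitution = TermSubst typeSubst

infix 8 _[_]ᵀ

_[_]ᵀ : Type (suc k) → Type k → Type k
A [ B ]ᵀ = A / sub B
  where open TypeSubstitution using (_/_; sub)

data Formula (k : ℕ) : Set where
  type : (A : Type k) → Formula k
  [_]§ : (A : Type k) → Formula k

-- A pair Γ;Δ of finite environments with disjoint domains amounts to
-- recording, for each variable in scope, whether it is declared in Γ
-- (nonlinear), in Δ (linear) or in neither (absent).

data Slot (k : ℕ) : Set where
  absent    : Slot k
  nonlinear : (A : Type k) → Slot k
  linear    : (F : Formula k) → Slot k

Env : ℕ → ℕ → Set
Env k n = Vec (Slot k) n

∅ : Env k n
∅ = replicate _ absent

infix 9 _↦_

_↦_ : Fin n → Slot k → Env k n
x ↦ s = ∅ [ x ]≔ s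

-- Weakening an environment by a type variable: the new variable is not
-- free in the result, and every environment in which it is not free
-- arises in this way.

weakenFormula : Formula k → Formula (suc k)
weakenFormula (type A) = type (TypeSubstitution.weaken A)
weakenFormula [ A ]§   = [ TypeSubstitution.weaken A ]§

weakenSlot : Slot k → Slot (suc k)
weakenSlot absent        = absent
weakenSlot (nonlinear A) = nonlinear (TypeSubstitution.weaken A)
weakenSlot (linear F)    = linear (weakenFormula F)

weakenEnv : Env k n → Env (suc k) n
weakenEnv = map weakenSlot

-- Γ₁;Δ₁ ⊎ Γ₂;Δ₂ ≔ Γ;Δ holds when Γ₁,Δ₁ and Γ₂,Δ₂ have disjoint domains
-- and Γ = Γ₁,Γ₂ and Δ = Δ₁,Δ₂.

data _⊎ˢ_≔_ {k : ℕ} : Slot k → Slot k → Slot k → Set where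
  left  : ∀ {s} → s ⊎ˢ absent ≔ s
  right : ∀ {s} → absent ⊎ˢ s ≔ s

infix 4 _⊎_≔_

data _⊎_≔_ {k : ℕ} : Env k n → Env k n → Env k n → Set where
  []  : [] ⊎ [] ≔ []
  _∷_ : ∀ {s₁ s₂ s} {E₁ E₂ E : Env k n} →
        s₁ ⊎ˢ s₂ ≔ s → E₁ ⊎ E₂ ≔ E → (s₁ ∷ E₁) ⊎ (s₂ ∷ E₂) ≔ (s ∷ E)

-- The passage from the premise to the conclusion of (§ i): each linear
-- variable of the premise becomes nonlinear or discharged.

data _⇝§_ {k : ℕ} : Slot k → Slot k → Set where
  absent    : absent ⇝§ absent
  nonlinear : ∀ {A} → linear (type A) ⇝§ nonlinear A
  discharge : ∀ {A} → linear (type A) ⇝§ linear [ A ]§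

-- Variables bound or substituted away by a rule are the innermost
-- variables of the premise concerned.

infix 4 _⊢_∶_

data _⊢_∶_ {k n : ℕ} : Env k n → Term n → Type k → Set where

  Id   : ∀ {x A} →
         x ↦ linear (type A) ⊢ var x ∶ A

  ⊸-i  : ∀ {E t A B} →
         linear (type A) ∷ E ⊢ t ∶ B →
         E ⊢ ƛ t ∶ A ⊸ B

  ⊸-e  : ∀ {E₁ E₂ E t u A B} →
         E₁ ⊢ t ∶ A ⊸ B →
         E₂ ⊢ u ∶ A →
         E₁ ⊎ E₂ ≔ E →
         E ⊢ t · u ∶ B

  ⇒-i  : ∀ {E t A B} →
         nonlinear A ∷ E ⊢ t ∶ B →
         E ⊢ ƛ t ∶ A ⇒ B

  ⇒-e  : ∀ {E₁ E t u z A B C} →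
         E₁ ⊢ t ∶ A ⇒ B →
         z ↦ linear (type C) ⊢ u ∶ A →
         E₁ ⊎ z ↦ nonlinear C ≔ E →
         E ⊢ t · u ∶ B

  ⇒-e∅ : ∀ {E t u A B} →
         E ⊢ t ∶ A ⇒ B →
         ∅ ⊢ u ∶ A →
         E ⊢ t · u ∶ B

  Weak : ∀ {E₁ E₂ E t A} →
         E₁ ⊢ t ∶ A →
         E₁ ⊎ E₂ ≔ E →
         E ⊢ t ∶ A

  Cntr : ∀ {E₁ E t x A B} →
         nonlinear A ∷ nonlinear A ∷ E₁ ⊢ t ∶ B →
         E₁ ⊎ x ↦ nonlinear A ≔ E →
         E ⊢ contract x t ∶ B

  §-i  : ∀ {E′ E t A} →
         E′ ⊢ t ∶ A →
         Pointwise _⇝§_ E′ E →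
         E ⊢ t ∶ § A

  §-e  : ∀ {E₁ E₂ E t u A B} →
         E₁ ⊢ u ∶ § A →
         linear [ A ]§ ∷ E₂ ⊢ t ∶ B →
         E₁ ⊎ E₂ ≔ E →
         E ⊢ t [ u ] ∶ B

  ∀-i  : ∀ {E t A} →
         weakenEnv E ⊢ t ∶ A →
         E ⊢ t ∶ ∀′ A

  ∀-e  : ∀ {E t A B} →
         E ⊢ t ∶ ∀′ A →
         E ⊢ t ∶ A [ B ]ᵀ

{-# OPTIONS --safe #-}

-- DLAL is compared with a level calculus _∣_⊩_∶_ whose rules follow the term
-- except for the rules of § and ∀, which leave it unchanged: (§ i) pushes an
-- empty frame on a stack of environments, (§ e) pops one, and linearity means
-- that a variable occurs at most once.  There substitution is structural and
-- abstractions can be inverted, so β-reduction preserves types; it does not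
-- increase the number of occurrences of a linear variable either, because only
-- arguments of type A ⇒ B functions are duplicated, and their variables are
-- nonlinear.
--
-- DLAL derivations embed into the level calculus, reading a discharged formula
-- [A]§ as § A.  Conversely, a level derivation is cut into slices, one for each
-- change of level: the topmost slice is a DLAL derivation of a term t′ in which
-- every subterm typed by popping a frame is replaced by a fresh linear
-- variable.  When the frame is closed by (§ i) these variables become
-- discharged, and (§ e) of DLAL substitutes the slices below for them.

module Submission where

open import Algebra.Properties.CommutativeSemigroup using (interchange)
open import Data.Fin.Base using (Fin; zero; suc; toℕ; _↑ˡ_; _↑ʳ_; splitAt)
open import Data.Fin.Properties
  using (_≟_; suc-injective; toℕ<n; toℕ-↑ˡ; toℕ-↑ʳ; splitAt-↑ˡ; splitAt-↑ʳ; splitAt⁻¹-↑ˡ; splitAt⁻¹-↑ʳ)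
open import Data.Fin.Substitution using (Lift; Sub; Subs; TermSubst; module VarSubst)
open import Data.Fin.Substitution.Lemmas using (TermLemmas; module VarLemmas)
open import Data.Maybe.Base as Maybe using (Maybe; just; nothing; maybe′)
open import Data.Nat.Base using (ℕ; zero; suc; _+_; _*_; _≤_; _<_; z≤n; s≤s)
open import Data.Nat.Properties hiding (_≟_; suc-injective)
open import Data.Product.Base using (_×_; _,_; proj₁; proj₂; ∃-syntax)
open import Data.Sum.Base using (inj₁; inj₂; [_,_]′) renaming (_⊎_ to _⊎′_)
open import Data.Vec.Base using ([]; _∷_; _++_; _[_]≔_; lookup; map; tabulate)
open import Data.Vec.Properties
  using ( lookup-map; lookup∘update; lookup∘update′; lookup-replicate; lookup∘tabulate; tabulate∘lookup
        ; tabulate-cong; lookup-splitAt; lookup-++ˡ; lookup-++ʳ; []≔-++-↑ʳ)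
open import Data.Vec.Relation.Binary.Pointwise.Inductive as Pointwise using (Pointwise; []; _∷_)
open import Function.Base using (_∘_; id; const; case_of_)
open import Relation.Binary.Construct.Closure.ReflexiveTransitive using (ε; _◅_)
open import Relation.Binary.PropositionalEquality
  using (_≡_; _≢_; _≗_; refl; sym; trans; cong; cong₂; subst; subst₂; module ≡-Reasoning)
open import Relation.Nullary.Decidable using (yes; no)
open import Relation.Nullary.Negation using (contradiction)
open import Defs

-- The obstacle is that (§ e) and (Cntr) of DLAL substitute into their subject. The last rule of a
-- derivation does not show where the redex lies, and (§ e) can even create one: in `t [ u ]` the
-- abstraction may come from `u : § (A ⊸ B)` and its argument from `t`.
--
-- The level calculus shares its environment between premises instead of splitting it, so
-- substitution and reduction have no splittings to track. The price is that linearity survives only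
-- as occurrence bounds: one at each `⊸-i`, one at each `⇒-e` and, for the free variables, `Affine`.
-- Turning bounds back into disjoint environments is what the condition `Used` on slices is for.

private
  variable
    j k l m n o M N : ℕ

-- Renaming and substitution of terms

infixr 5 _∷ᶠ_

_∷ᶠ_ : {P : Set} → P → (Fin n → P) → Fin (suc n) → P
(a ∷ᶠ f) zero    = a
(a ∷ᶠ f) (suc x) = f x

ext : (Fin m → Fin n) → Fin (suc m) → Fin (suc n)
ext ρ = zero ∷ᶠ suc ∘ ρ

ren : (Fin m → Fin n) → Term m → Term n
ren ρ (var x) = var (ρ x)
ren ρ (ƛ t)   = ƛ (ren (ext ρ) t)
ren ρ (t · u) = ren ρ t · ren ρ u

exts : (Fin m → Term n) → Fin (suc m) → Term (suc n)
exts σ = var zero ∷ᶠ ren suc ∘ σ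

sub : (Fin m → Term n) → Term m → Term n
sub σ (var x) = σ x
sub σ (ƛ t)   = ƛ (sub (exts σ) t)
sub σ (t · u) = sub σ t · sub σ u

sub-cong : {σ τ : Fin m → Term n} → σ ≗ τ → sub σ ≗ sub τ
sub-cong e (var x) = e x
sub-cong e (ƛ t)   = cong ƛ (sub-cong (λ { zero → refl ; (suc x) → cong (ren suc) (e x) }) t)
sub-cong e (t · u) = cong₂ _·_ (sub-cong e t) (sub-cong e u)

ren≗sub : (ρ : Fin m → Fin n) → ren ρ ≗ sub (var ∘ ρ)
ren≗sub ρ (var x) = refl
ren≗sub ρ (ƛ t)   = cong ƛ (trans (ren≗sub (ext ρ) t)
  (sub-cong (λ { zero → refl ; (suc x) → refl }) t))
ren≗sub ρ (t · u) = cong₂ _·_ (ren≗sub ρ t) (ren≗sub ρ u)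

sub-var : (t : Term n) → sub var t ≡ t
sub-var (var x) = refl
sub-var (ƛ t)   = cong ƛ (trans (sub-cong (λ { zero → refl ; (suc x) → refl }) t) (sub-var t))
sub-var (t · u) = cong₂ _·_ (sub-var t) (sub-var u)

sub-ren : (σ : Fin n → Term o) (ρ : Fin m → Fin n) → sub σ ∘ ren ρ ≗ sub (σ ∘ ρ)
sub-ren σ ρ (var x) = refl
sub-ren σ ρ (ƛ t)   = cong ƛ (trans (sub-ren (exts σ) (ext ρ) t)
  (sub-cong (λ { zero → refl ; (suc x) → refl }) t))
sub-ren σ ρ (t · u) = cong₂ _·_ (sub-ren σ ρ t) (sub-ren σ ρ u)

ren-ren : (ρ′ : Fin n → Fin o) (ρ : Fin m → Fin n) → ren ρ′ ∘ ren ρ ≗ ren (ρ′ ∘ ρ)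
ren-ren ρ′ ρ t = trans (ren≗sub ρ′ (ren ρ t))
  (trans (sub-ren (var ∘ ρ′) ρ t) (sym (ren≗sub (ρ′ ∘ ρ) t)))

ren-sub : (ρ : Fin n → Fin o) (σ : Fin m → Term n) → ren ρ ∘ sub σ ≗ sub (ren ρ ∘ σ)
ren-sub ρ σ (var x) = refl
ren-sub ρ σ (ƛ t)   = cong ƛ (trans (ren-sub (ext ρ) (exts σ) t) (sub-cong lemma t))
  where
  lemma : ren (ext ρ) ∘ exts σ ≗ exts (ren ρ ∘ σ)
  lemma zero    = refl
  lemma (suc x) = trans (ren-ren (ext ρ) suc (σ x)) (sym (ren-ren suc ρ (σ x)))
ren-sub ρ σ (t · u) = cong₂ _·_ (ren-sub ρ σ t) (ren-sub ρ σ u)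

sub-sub : (τ : Fin n → Term o) (σ : Fin m → Term n) → sub τ ∘ sub σ ≗ sub (sub τ ∘ σ)
sub-sub τ σ (var x) = refl
sub-sub τ σ (ƛ t)   = cong ƛ (trans (sub-sub (exts τ) (exts σ) t) (sub-cong lemma t))
  where
  lemma : sub (exts τ) ∘ exts σ ≗ exts (sub τ ∘ σ)
  lemma zero    = refl
  lemma (suc x) = trans (sub-ren (exts τ) suc (σ x)) (sym (ren-sub suc τ (σ x)))
sub-sub τ σ (t · u) = cong₂ _·_ (sub-sub τ σ t) (sub-sub τ σ u)

ren-cong : {ρ ρ′ : Fin m → Fin n} → ρ ≗ ρ′ → ren ρ ≗ ren ρ′
ren-cong {ρ = ρ} {ρ′} e t = trans (ren≗sub ρ t)
  (trans (sub-cong (cong var ∘ e) t) (sym (ren≗sub ρ′ t)))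

module TS = TermSubstitution

-- The DLAL rules and β use the library's vector substitutions, while the proof computes with
-- functions `Fin m → Term n`, whose laws are pointwise. The lemmas down to `contract≡sub` translate
-- between the two.
/Var≡ren : (ρ : Sub Fin m n) (t : Term m) → t TS./Var ρ ≡ ren (lookup ρ) t
/Var≡ren ρ (var x) = refl
/Var≡ren ρ (ƛ t)   = cong ƛ (trans (/Var≡ren _ t)
  (ren-cong (λ { zero → refl ; (suc x) → lookup-map x suc ρ }) t))
/Var≡ren ρ (t · u) = cong₂ _·_ (/Var≡ren ρ t) (/Var≡ren ρ u)

weaken≡ren : (t : Term n) → TS.weaken t ≡ ren suc t
weaken≡ren t = trans (/Var≡ren VarSubst.wk t) (ren-cong VarLemmas.lookup-wk t)

/≡sub : (ρ : Sub Term m n) (t : Term m) → t TS./ ρ ≡ sub (lookup ρ) t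
/≡sub ρ (var x) = refl
/≡sub ρ (ƛ t)   = cong ƛ (trans (/≡sub (ρ TS.↑) t)
  (sub-cong (λ { zero → refl
               ; (suc x) → trans (lookup-map x TS.weaken ρ) (weaken≡ren (lookup ρ x)) }) t))
/≡sub ρ (t · u) = cong₂ _·_ (/≡sub ρ t) (/≡sub ρ u)

lookup-id : (x : Fin n) → lookup TS.id x ≡ var x
lookup-id zero    = refl
lookup-id (suc x) = trans (lookup-map x TS.weaken TS.id)
  (trans (weaken≡ren (lookup TS.id x)) (cong (ren suc) (lookup-id x)))

[]≡sub : (t : Term (suc n)) (u : Term n) → t [ u ] ≡ sub (u ∷ᶠ var) t
[]≡sub t u = trans (/≡sub (TS.sub u) t)
  (sub-cong (λ { zero → refl ; (suc x) → lookup-id x }) t)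

contract≡sub : (x : Fin n) (t : Term (suc (suc n))) →
               contract x t ≡ sub (var x ∷ᶠ var x ∷ᶠ var) t
contract≡sub x t = trans (/Var≡ren _ t) (trans (ren≗sub _ t)
  (sub-cong (λ { zero → refl ; (suc zero) → refl
               ; (suc (suc y)) → cong var (VarLemmas.lookup-id y) }) t))

-- Weighted occurrence counts

-- With w = δ x this counts the occurrences of x, and with w = const 1 all free
-- occurrences; arbitrary weights make counting compositional (‖‖-sub).

‖_‖ : Term n → (Fin n → ℕ) → ℕ
‖ var x ‖ w = w x
‖ ƛ t   ‖ w = ‖ t ‖ (0 ∷ᶠ w)
‖ t · u ‖ w = ‖ t ‖ w + ‖ u ‖ w

δ : Fin n → Fin n → ℕ
δ zero    = 1 ∷ᶠ const 0
δ (suc x) = 0 ∷ᶠ δ x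

data _∈ᶠ_ {n : ℕ} : Fin n → Term n → Set where
  var : ∀ {x} → x ∈ᶠ var x
  ƛ   : ∀ {x t} → suc x ∈ᶠ t → x ∈ᶠ ƛ t
  ·ˡ  : ∀ {x t u} → x ∈ᶠ t → x ∈ᶠ (t · u)
  ·ʳ  : ∀ {x t u} → x ∈ᶠ u → x ∈ᶠ (t · u)

-- Only the weights of free variables matter; with `free-live` this turns a typing derivation into a
-- bound on occurrences.
‖‖-mono-∈ : (t : Term n) {v w : Fin n → ℕ} → (∀ x → x ∈ᶠ t → v x ≤ w x) → ‖ t ‖ v ≤ ‖ t ‖ w
‖‖-mono-∈ (var x) h = h x var
‖‖-mono-∈ (ƛ t)   h = ‖‖-mono-∈ t λ { zero _ → z≤n ; (suc x) p → h x (ƛ p) }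
‖‖-mono-∈ (t · u) h = +-mono-≤ (‖‖-mono-∈ t (λ x → h x ∘ ·ˡ)) (‖‖-mono-∈ u (λ x → h x ∘ ·ʳ))

‖‖-mono : (t : Term n) {v w : Fin n → ℕ} → (∀ x → v x ≤ w x) → ‖ t ‖ v ≤ ‖ t ‖ w
‖‖-mono t h = ‖‖-mono-∈ t λ x _ → h x

‖‖-cong : (t : Term n) {v w : Fin n → ℕ} → v ≗ w → ‖ t ‖ v ≡ ‖ t ‖ w
‖‖-cong t e = ≤-antisym (‖‖-mono t (≤-reflexive ∘ e)) (‖‖-mono t (≤-reflexive ∘ sym ∘ e))

‖‖-+ : (t : Term n) (v w : Fin n → ℕ) → ‖ t ‖ (λ x → v x + w x) ≡ ‖ t ‖ v + ‖ t ‖ w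
‖‖-+ (var x) v w = refl
‖‖-+ (ƛ t)   v w = trans (‖‖-cong t λ { zero → refl ; (suc x) → refl }) (‖‖-+ t (0 ∷ᶠ v) (0 ∷ᶠ w))
‖‖-+ (t · u) v w = trans (cong₂ _+_ (‖‖-+ t v w) (‖‖-+ u v w))
  (interchange +-commutativeSemigroup (‖ t ‖ v) (‖ t ‖ w) (‖ u ‖ v) (‖ u ‖ w))

‖‖-* : (t : Term n) (c : ℕ) (w : Fin n → ℕ) → ‖ t ‖ (λ x → c * w x) ≡ c * ‖ t ‖ w
‖‖-* (var x) c w = refl
‖‖-* (ƛ t)   c w = trans (‖‖-cong t λ { zero → sym (*-zeroʳ c) ; (suc x) → refl }) (‖‖-* t c (0 ∷ᶠ w))
‖‖-* (t · u) c w = trans (cong₂ _+_ (‖‖-* t c w) (‖‖-* u c w)) (sym (*-distribˡ-+ c (‖ t ‖ w) (‖ u ‖ w)))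

‖‖-0 : (t : Term n) → ‖ t ‖ (const 0) ≡ 0
‖‖-0 t = ‖‖-* t 0 (const 0)

-- Writing `c ∷ᶠ w` as `c * δ zero` plus `0 ∷ᶠ w` isolates the innermost variable; for a β-redex `c`
-- is the weight of the argument.
‖‖-∷ : (t : Term (suc n)) (c : ℕ) (w : Fin n → ℕ) →
       ‖ t ‖ (c ∷ᶠ w) ≡ c * ‖ t ‖ (δ zero) + ‖ t ‖ (0 ∷ᶠ w)
‖‖-∷ t c w = trans (‖‖-cong t lemma)
  (trans (‖‖-+ t (λ x → c * δ zero x) (0 ∷ᶠ w))
         (cong (_+ ‖ t ‖ (0 ∷ᶠ w)) (‖‖-* t c (δ zero))))
  where
  lemma : c ∷ᶠ w ≗ (λ x → c * δ zero x + (0 ∷ᶠ w) x)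
  lemma zero    = sym (trans (+-identityʳ (c * 1)) (*-identityʳ c))
  lemma (suc x) = cong (_+ w x) (sym (*-zeroʳ c))

‖‖-ren : (ρ : Fin m → Fin n) (t : Term m) (w : Fin n → ℕ) → ‖ ren ρ t ‖ w ≡ ‖ t ‖ (w ∘ ρ)
‖‖-ren ρ (var x) w = refl
‖‖-ren ρ (ƛ t)   w = trans (‖‖-ren (ext ρ) t (0 ∷ᶠ w)) (‖‖-cong t λ { zero → refl ; (suc x) → refl })
‖‖-ren ρ (t · u) w = cong₂ _+_ (‖‖-ren ρ t w) (‖‖-ren ρ u w)

‖‖-sub : (σ : Fin m → Term n) (t : Term m) (w : Fin n → ℕ) → ‖ sub σ t ‖ w ≡ ‖ t ‖ (λ x → ‖ σ x ‖ w)
‖‖-sub σ (var x) w = refl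
‖‖-sub σ (ƛ t)   w = trans (‖‖-sub (exts σ) t (0 ∷ᶠ w))
  (‖‖-cong t λ { zero → refl ; (suc x) → ‖‖-ren suc (σ x) (0 ∷ᶠ w) })
‖‖-sub σ (t · u) w = cong₂ _+_ (‖‖-sub σ t w) (‖‖-sub σ u w)

-- Type substitution

typeLemmas : TermLemmas Type
typeLemmas = record { termSubst = typeSubst ; app-var = refl ; /✶-↑✶ = /✶-↑✶ }
  where
  open TermSubst typeSubst using (module Lifted)

  module _ {T : ℕ → Set} (lift : Lift T Type) where
    open Lifted lift

    ⊸-/✶ : ∀ h (ρs : Subs T m n) A B →
           (A ⊸ B) /✶ ρs ↑✶ h ≡ (A /✶ ρs ↑✶ h) ⊸ (B /✶ ρs ↑✶ h)
    ⊸-/✶ h ε        A B = refl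
    ⊸-/✶ h (ρ ◅ ρs) A B = cong (_/ ρ ↑⋆ h) (⊸-/✶ h ρs A B)

    ⇒-/✶ : ∀ h (ρs : Subs T m n) A B →
           (A ⇒ B) /✶ ρs ↑✶ h ≡ (A /✶ ρs ↑✶ h) ⇒ (B /✶ ρs ↑✶ h)
    ⇒-/✶ h ε        A B = refl
    ⇒-/✶ h (ρ ◅ ρs) A B = cong (_/ ρ ↑⋆ h) (⇒-/✶ h ρs A B)

    §-/✶ : ∀ h (ρs : Subs T m n) A → (§ A) /✶ ρs ↑✶ h ≡ § (A /✶ ρs ↑✶ h)
    §-/✶ h ε        A = refl
    §-/✶ h (ρ ◅ ρs) A = cong (_/ ρ ↑⋆ h) (§-/✶ h ρs A)

    ∀-/✶ : ∀ h (ρs : Subs T m n) A → ∀′ A /✶ ρs ↑✶ h ≡ ∀′ (A /✶ ρs ↑✶ suc h)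
    ∀-/✶ h ε        A = refl
    ∀-/✶ h (ρ ◅ ρs) A = cong (_/ ρ ↑⋆ h) (∀-/✶ h ρs A)

  module _ {T₁ T₂ : ℕ → Set} {l₁ : Lift T₁ Type} {l₂ : Lift T₂ Type} where
    open Lifted l₁ using () renaming (_↑✶_ to _↑✶₁_; _/✶_ to _/✶₁_)
    open Lifted l₂ using () renaming (_↑✶_ to _↑✶₂_; _/✶_ to _/✶₂_)

    /✶-↑✶ : (ρs₁ : Subs T₁ m n) (ρs₂ : Subs T₂ m n) →
            (∀ h x → Type.var x /✶₁ ρs₁ ↑✶₁ h ≡ Type.var x /✶₂ ρs₂ ↑✶₂ h) →
            ∀ h A → A /✶₁ ρs₁ ↑✶₁ h ≡ A /✶₂ ρs₂ ↑✶₂ h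
    /✶-↑✶ ρs₁ ρs₂ hyp h (var α) = hyp h α
    /✶-↑✶ ρs₁ ρs₂ hyp h (A ⊸ B) = trans (⊸-/✶ l₁ h ρs₁ A B)
      (trans (cong₂ _⊸_ (/✶-↑✶ ρs₁ ρs₂ hyp h A) (/✶-↑✶ ρs₁ ρs₂ hyp h B))
             (sym (⊸-/✶ l₂ h ρs₂ A B)))
    /✶-↑✶ ρs₁ ρs₂ hyp h (A ⇒ B) = trans (⇒-/✶ l₁ h ρs₁ A B)
      (trans (cong₂ _⇒_ (/✶-↑✶ ρs₁ ρs₂ hyp h A) (/✶-↑✶ ρs₁ ρs₂ hyp h B))
             (sym (⇒-/✶ l₂ h ρs₂ A B)))
    /✶-↑✶ ρs₁ ρs₂ hyp h (§ A) = trans (§-/✶ l₁ h ρs₁ A)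
      (trans (cong §_ (/✶-↑✶ ρs₁ ρs₂ hyp h A)) (sym (§-/✶ l₂ h ρs₂ A)))
    /✶-↑✶ ρs₁ ρs₂ hyp h (∀′ A) = trans (∀-/✶ l₁ h ρs₁ A)
      (trans (cong ∀′ (/✶-↑✶ ρs₁ ρs₂ hyp (suc h) A)) (sym (∀-/✶ l₂ h ρs₂ A)))

-- The level calculus

module Ty = TypeSubstitution
open Ty using (_/_; _⊙_; weaken; wk; _↑)
module TL = TermLemmas typeLemmas

Frame : ℕ → ℕ → Set
Frame k n = Fin n → Slot k

infixl 5 _▸_⟨_⟩

-- S ▸ D ⟨ θ ⟩ lies below the current frame; D is one level down and has its
-- own scope j of type variables, which θ instantiates at the current level.  A
-- variable quantified at the current level thus cannot occur in D.

data Stack (n : ℕ) : ℕ → Set where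
  ε      : Stack n k
  _▸_⟨_⟩ : Stack n j → Frame j n → Sub Type j k → Stack n k

bind : Stack n k → Stack (suc n) k
bind ε             = ε
bind (S ▸ D ⟨ θ ⟩) = bind S ▸ (absent ∷ᶠ D) ⟨ θ ⟩

generalise : Stack n k → Stack n (suc k)
generalise ε             = ε
generalise (S ▸ D ⟨ θ ⟩) = S ▸ D ⟨ map weaken θ ⟩

⌊_⌋ : Formula k → Type k
⌊ type A ⌋ = A
⌊ [ A ]§ ⌋ = § A

-- What the argument of a function of type `A ⇒ B` may see: the `z : C` of (⇒ e) is nonlinear in the
-- conclusion and linear in the premise. Linear variables are withheld, since the argument may be
-- copied.
bang : Slot k → Slot k
bang (nonlinear A) = linear (type A)
bang _             = absent

private
  variable
    S S′ : Stack n k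
    D D′ E E′ : Frame k n
    Γ Γ₁ Γ₂ Γ′ F G : Env k n
    s : Slot k
    L : Formula k
    A B C : Type k
    t u : Term n
    x y : Fin n
    θ σ : Sub Type j k

infix 4 _∣_∋_∶_ _∣_⊩_∶_

-- A linear variable is available at the level of its declaration, a nonlinear one exactly one level
-- higher; at its own level the latter is reachable only through `bang`, inside an argument of
-- `⇒-e`. Deeper frames are reached by popping with `§-e`.
data _∣_∋_∶_ {n k} : Stack n k → Frame k n → Fin n → Type k → Set where
  here  : E x ≡ linear L → S ∣ E ∋ x ∶ ⌊ L ⌋
  below : D x ≡ nonlinear A → S ▸ D ⟨ θ ⟩ ∣ E ∋ x ∶ A / θ

-- In (⇒ e) the argument starts a derivation of its own at level 0, with at most
-- one free occurrence of a variable.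

data _∣_⊩_∶_ {n k} : Stack n k → Frame k n → Term n → Type k → Set where
  var-i : S ∣ E ∋ x ∶ A → S ∣ E ⊩ var x ∶ A
  ⊸-i   : bind S ∣ linear (type A) ∷ᶠ E ⊩ t ∶ B → ‖ t ‖ (δ zero) ≤ 1 → S ∣ E ⊩ ƛ t ∶ A ⊸ B
  ⊸-e   : S ∣ E ⊩ t ∶ A ⊸ B → S ∣ E ⊩ u ∶ A → S ∣ E ⊩ t · u ∶ B
  ⇒-i   : bind S ∣ nonlinear A ∷ᶠ E ⊩ t ∶ B → S ∣ E ⊩ ƛ t ∶ A ⇒ B
  ⇒-e   : S ∣ E ⊩ t ∶ A ⇒ B → ε ∣ bang ∘ E ⊩ u ∶ A → ‖ u ‖ (const 1) ≤ 1 → S ∣ E ⊩ t · u ∶ B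
  §-i   : S ▸ E ⟨ Ty.id ⟩ ∣ const absent ⊩ t ∶ A → S ∣ E ⊩ t ∶ § A
  §-e   : S ∣ D ⊩ t ∶ § A → S ▸ D ⟨ θ ⟩ ∣ E ⊩ t ∶ A / θ
  ∀-i   : generalise S ∣ weakenSlot ∘ E ⊩ t ∶ A → S ∣ E ⊩ t ∶ ∀′ A
  ∀-e   : S ∣ E ⊩ t ∶ ∀′ A → S ∣ E ⊩ t ∶ A [ B ]ᵀ

-- Renaming

-- `lin` asks for a typing and not for a linear slot: a linear variable may become one supplied by
-- the frame below, as `⊩-unbox` requires.
record Carries (ρ : Fin m → Fin n) (σ : Sub Type j k) (E : Frame j m)
               (S′ : Stack n k) (E′ : Frame k n) : Set where
  field
    lin : ∀ {x L} → E x ≡ linear L → S′ ∣ E′ ∋ ρ x ∶ ⌊ L ⌋ / σ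
    non : ∀ {x A} → E x ≡ nonlinear A → E′ (ρ x) ≡ nonlinear (A / σ)

open Carries

-- The target of ε is arbitrary: derivations at level 0 can be moved to any level.

data Maps (ρ : Fin m → Fin n) : Sub Type j k → Stack m j → Stack n k → Set where
  ε      : Maps ρ σ ε S′
  _▸_⟨_⟩ : ∀ {τ : Sub Type j k} {θ : Sub Type j l} {θ′ : Sub Type k o} {σ : Sub Type l o} →
           Maps ρ τ S S′ → Carries ρ τ D S′ D′ → θ ⊙ σ ≡ τ ⊙ θ′ →
           Maps ρ σ (S ▸ D ⟨ θ ⟩) (S′ ▸ D′ ⟨ θ′ ⟩)

⌊⌋-weaken : (L : Formula k) → ⌊ weakenFormula L ⌋ ≡ weaken ⌊ L ⌋
⌊⌋-weaken (type A) = refl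
⌊⌋-weaken [ A ]§   = refl

weaken-linear : (s : Slot k) {L : Formula (suc k)} → weakenSlot s ≡ linear L →
                ∃[ L₀ ] s ≡ linear L₀ × L ≡ weakenFormula L₀
weaken-linear (linear L) refl = L , refl , refl

weaken-nonlinear : (s : Slot k) {A : Type (suc k)} → weakenSlot s ≡ nonlinear A →
                   ∃[ A₀ ] s ≡ nonlinear A₀ × A ≡ weaken A₀
weaken-nonlinear (nonlinear A) refl = A , refl , refl

bang-linear : (s : Slot k) {L : Formula k} → bang s ≡ linear L →
              ∃[ A ] s ≡ nonlinear A × L ≡ type A
bang-linear (nonlinear A) refl = A , refl , refl

bang-nonlinear : (s : Slot k) {A : Type k} → bang s ≢ nonlinear A
bang-nonlinear absent        ()
bang-nonlinear (nonlinear A) ()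
bang-nonlinear (linear L)    ()

/-wk : (A : Type k) → A / wk ≡ weaken A
/-wk A = TL./-wk {t = A}

/-map-weaken : (A : Type j) (θ : Sub Type j k) → A / map weaken θ ≡ weaken (A / θ)
/-map-weaken A θ = trans (TL./-weaken A) (/-wk (A / θ))

∋-bind : {s : Slot k} → S ∣ E ∋ x ∶ A → bind S ∣ s ∷ᶠ E ∋ suc x ∶ A
∋-bind (here e)  = here e
∋-bind (below e) = below e

∋-generalise : S ∣ E ∋ x ∶ A → generalise S ∣ weakenSlot ∘ E ∋ x ∶ weaken A
∋-generalise (here {L = L} e) =
  subst (_ ∣ _ ∋ _ ∶_) (⌊⌋-weaken L) (here (cong weakenSlot e))
∋-generalise (below {A = A} {θ = θ} e) =
  subst (_ ∣ _ ∋ _ ∶_) (/-map-weaken A θ) (below e)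

subFormula : Sub Type j k → Formula j → Formula k
subFormula σ (type A) = type (A / σ)
subFormula σ [ A ]§   = [ A / σ ]§

subSlot : Sub Type j k → Slot j → Slot k
subSlot σ absent        = absent
subSlot σ (nonlinear A) = nonlinear (A / σ)
subSlot σ (linear L)    = linear (subFormula σ L)

⌊⌋-sub : (L : Formula j) → ⌊ subFormula σ L ⌋ ≡ ⌊ L ⌋ / σ
⌊⌋-sub (type A) = refl
⌊⌋-sub [ A ]§   = refl

carries-bind : {ρ : Fin m → Fin n} → Carries ρ σ E S′ E′ → (s : Slot j) →
               Carries (ext ρ) σ (s ∷ᶠ E) (bind S′) (subSlot σ s ∷ᶠ E′)
carries-bind {S′ = S′} {E′ = E′} c (linear L) .lin {zero} refl =
  subst (bind S′ ∣ linear (subFormula _ L) ∷ᶠ E′ ∋ zero ∶_) (⌊⌋-sub L) (here refl)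
carries-bind c s .lin {suc x} e   = ∋-bind (c .lin e)
carries-bind c s .non {zero} refl = refl
carries-bind c s .non {suc x} e   = c .non e

maps-bind : {ρ : Fin m → Fin n} → Maps ρ σ S S′ → Maps (ext ρ) σ (bind S) (bind S′)
maps-bind ε             = ε
maps-bind (m ▸ c ⟨ e ⟩) = maps-bind m ▸ carries-bind c absent ⟨ e ⟩

carries-generalise : {ρ : Fin m → Fin n} → Carries ρ σ E S′ E′ →
                     Carries ρ (σ ↑) (weakenSlot ∘ E) (generalise S′) (weakenSlot ∘ E′)
carries-generalise {σ = σ} {E = E} c .lin {x} e with weaken-linear (E x) e
... | L , e′ , refl = subst (_ ∣ _ ∋ _ ∶_)
  (sym (trans (cong (_/ σ ↑) (⌊⌋-weaken L)) (TL.weaken-↑ ⌊ L ⌋)))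
  (∋-generalise (c .lin e′))
carries-generalise {E = E} c .non {x} e with weaken-nonlinear (E x) e
... | A , e′ , refl = trans (cong weakenSlot (c .non e′)) (cong nonlinear (sym (TL.weaken-↑ A)))

maps-generalise : {ρ : Fin m → Fin n} → Maps ρ σ S S′ →
                  Maps ρ (σ ↑) (generalise S) (generalise S′)
maps-generalise ε = ε
maps-generalise {σ = σ} (_▸_⟨_⟩ {τ = τ} {θ = θ} {θ′ = θ′} m c e) = m ▸ c ⟨ square ⟩
  where
  open ≡-Reasoning
  square : map weaken θ ⊙ σ ↑ ≡ τ ⊙ map weaken θ′
  square = begin
    map weaken θ ⊙ σ ↑  ≡⟨ cong (_⊙ σ ↑) TL.map-weaken ⟩
    (θ ⊙ wk) ⊙ σ ↑      ≡⟨ TL.⊙-assoc ⟨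
    θ ⊙ (wk ⊙ σ ↑)      ≡⟨ cong (θ ⊙_) TL.⊙-wk ⟨
    θ ⊙ (σ ⊙ wk)        ≡⟨ TL.⊙-assoc ⟩
    (θ ⊙ σ) ⊙ wk        ≡⟨ cong (_⊙ wk) e ⟩
    (τ ⊙ θ′) ⊙ wk       ≡⟨ TL.⊙-assoc ⟨
    τ ⊙ (θ′ ⊙ wk)       ≡⟨ cong (τ ⊙_) TL.map-weaken ⟨
    τ ⊙ map weaken θ′   ∎

carries-bang : {ρ : Fin m → Fin n} → Carries ρ σ E S′ E′ → Carries ρ σ (bang ∘ E) ε (bang ∘ E′)
carries-bang {E = E} c .lin {x} e with bang-linear (E x) e
... | A , e′ , refl = here (cong bang (c .non e′))
carries-bang {E = E} c .non {x} e with () ← bang-nonlinear (E x) e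

carries-absent : {ρ : Fin m → Fin n} → Carries ρ σ (const absent) S′ E′
carries-absent .lin ()
carries-absent .non ()

∋-ren : {ρ : Fin m → Fin n} → Maps ρ σ S S′ → Carries ρ σ E S′ E′ →
        S ∣ E ∋ x ∶ A → S′ ∣ E′ ∋ ρ x ∶ A / σ
∋-ren m c (here e) = c .lin e
∋-ren {σ = σ} (_▸_⟨_⟩ {τ = τ} {θ′ = θ′} m c′ e′) c (below {A = A} {θ = θ} e) =
  subst (_ ∣ _ ∋ _ ∶_)
    (trans (sym (TL./-⊙ A)) (trans (cong (A /_) (sym e′)) (TL./-⊙ A)))
    (below (c′ .non e))

-- Types are instantiated along with the renaming. At `§-e` the type substitution of the current
-- level is exchanged for that of the level below, along the commuting square stored in `Maps`.
⊩-ren : {ρ : Fin m → Fin n} → Maps ρ σ S S′ → Carries ρ σ E S′ E′ →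
        S ∣ E ⊩ t ∶ A → S′ ∣ E′ ⊩ ren ρ t ∶ A / σ
⊩-ren m c (var-i p) = var-i (∋-ren m c p)
⊩-ren {ρ = ρ} m c (⊸-i {t = t} d q) = ⊸-i (⊩-ren (maps-bind m) (carries-bind c _) d)
  (subst (_≤ 1) (sym (trans (‖‖-ren (ext ρ) t (δ zero))
    (‖‖-cong t λ { zero → refl ; (suc x) → refl }))) q)
⊩-ren m c (⊸-e d d′) = ⊸-e (⊩-ren m c d) (⊩-ren m c d′)
⊩-ren m c (⇒-i d) = ⇒-i (⊩-ren (maps-bind m) (carries-bind c _) d)
⊩-ren {ρ = ρ} m c (⇒-e {u = u} d d′ q) = ⇒-e (⊩-ren m c d) (⊩-ren ε (carries-bang c) d′)
  (subst (_≤ 1) (sym (‖‖-ren ρ u (const 1))) q)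
⊩-ren m c (§-i d) = §-i (⊩-ren (m ▸ c ⟨ trans TL.id-⊙ (sym TL.⊙-id) ⟩) carries-absent d)
⊩-ren (m ▸ c′ ⟨ e ⟩) c (§-e {A = A} d) =
  subst (_ ∣ _ ⊩ _ ∶_)
    (trans (sym (TL./-⊙ A)) (trans (cong (A /_) (sym e)) (TL./-⊙ A)))
    (§-e (⊩-ren m c′ d))
⊩-ren m c (∀-i d) = ∀-i (⊩-ren (maps-generalise m) (carries-generalise c) d)
⊩-ren m c (∀-e {A = A} d) = subst (_ ∣ _ ⊩ _ ∶_) (sym (TL.sub-commutes A)) (∀-e (⊩-ren m c d))

carries-id : Carries id Ty.id E S E
carries-id .lin e = subst (_ ∣ _ ∋ _ ∶_) (sym (TL.id-vanishes _)) (here e)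
carries-id .non e = trans e (cong nonlinear (sym (TL.id-vanishes _)))

maps-id : Maps {n = n} id Ty.id S S
maps-id {S = ε}           = ε
maps-id {S = S ▸ D ⟨ θ ⟩} = maps-id ▸ carries-id ⟨ trans TL.⊙-id (sym TL.id-⊙) ⟩

carries-suc : {s : Slot k} → Carries suc Ty.id E S (s ∷ᶠ E)
carries-suc .lin e = subst (_ ∣ _ ∋ _ ∶_) (sym (TL.id-vanishes _)) (here e)
carries-suc .non e = trans e (cong nonlinear (sym (TL.id-vanishes _)))

maps-suc : Maps suc Ty.id S (bind S)
maps-suc {S = ε}           = ε
maps-suc {S = S ▸ D ⟨ θ ⟩} = maps-suc ▸ carries-suc ⟨ trans TL.⊙-id (sym TL.id-⊙) ⟩

⊩-bind : (s : Slot k) → S ∣ E ⊩ t ∶ A → bind S ∣ s ∷ᶠ E ⊩ ren suc t ∶ A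
⊩-bind s d = subst (_ ∣ _ ⊩ _ ∶_) (TL.id-vanishes _) (⊩-ren maps-suc carries-suc d)

ren-id : (t : Term n) → ren id t ≡ t
ren-id t = trans (ren≗sub id t) (sub-var t)

⊩-map : Maps id σ S S′ → Carries id σ E S′ E′ → S ∣ E ⊩ t ∶ A → S′ ∣ E′ ⊩ t ∶ A / σ
⊩-map {t = t} m c d = subst (_ ∣ _ ⊩_∶ _) (ren-id t) (⊩-ren m c d)

⊩-generalise : S ∣ E ⊩ t ∶ A → generalise S ∣ weakenSlot ∘ E ⊩ t ∶ weaken A
⊩-generalise {A = A} d = subst (_ ∣ _ ⊩ _ ∶_) (/-wk A) (⊩-map maps-wk carries-wk d)
  where
  maps-wk : Maps id wk S (generalise S)
  maps-wk {S = ε}           = ε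
  maps-wk {S = S ▸ D ⟨ θ ⟩} = maps-id ▸ carries-id ⟨ trans (sym TL.map-weaken) (sym TL.id-⊙) ⟩
  carries-wk : Carries id wk E (generalise S) (weakenSlot ∘ E)
  carries-wk .lin {L = L} e =
    subst (_ ∣ _ ∋ _ ∶_) (trans (⌊⌋-weaken L) (sym (/-wk ⌊ L ⌋))) (here (cong weakenSlot e))
  carries-wk .non {A = A} e = trans (cong weakenSlot e) (cong nonlinear (sym (/-wk A)))

-- This is why a nonlinear variable can be replaced by an argument of `⇒-e`: the argument is derived
-- at level 0 from banged variables, and each of these, being nonlinear in `D`, is available one
-- level above `D`.
⊩-unbox : ε ∣ bang ∘ D ⊩ t ∶ A → S ▸ D ⟨ θ ⟩ ∣ E ⊩ t ∶ A / θ
⊩-unbox {D = D} {S = S} {θ = θ} {E = E} = ⊩-map ε carries-unbox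
  where
  carries-unbox : Carries id θ (bang ∘ D) (S ▸ D ⟨ θ ⟩) E
  carries-unbox .lin {x} e with bang-linear (D x) e
  ... | A , e′ , refl = below e′
  carries-unbox .non {x} e with () ← bang-nonlinear (D x) e

-- Substitution

-- `non` repeats the premises of `⇒-e`. An argument of `⇒-e` therefore remains one after
-- substitution: it has at most one variable occurrence, and the image of that variable again has at
-- most one.
record CarriesT (τ : Fin m → Term n) (E : Frame k m) (S′ : Stack n k) (E′ : Frame k n) : Set where
  field
    lin : ∀ {x L} → E x ≡ linear L → S′ ∣ E′ ⊩ τ x ∶ ⌊ L ⌋
    non : ∀ {x A} → E x ≡ nonlinear A → ε ∣ bang ∘ E′ ⊩ τ x ∶ A × ‖ τ x ‖ (const 1) ≤ 1

open CarriesT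

data MapsT (τ : Fin m → Term n) : Stack m k → Stack n k → Set where
  ε   : MapsT τ {k} ε S′
  _▸_ : MapsT τ S S′ → CarriesT τ D S′ D′ → MapsT τ (S ▸ D ⟨ θ ⟩) (S′ ▸ D′ ⟨ θ ⟩)

bang-∷ : {s : Slot k} → ε ∣ bang ∘ E ⊩ t ∶ A → ε ∣ bang ∘ (s ∷ᶠ E) ⊩ ren suc t ∶ A
bang-∷ {E = E} {s = s} d = subst (_ ∣ _ ⊩ _ ∶_) (TL.id-vanishes _) (⊩-ren ε c d)
  where
  c : Carries suc Ty.id (bang ∘ E) ε (bang ∘ (s ∷ᶠ E))
  c .lin e = subst (_ ∣ _ ∋ _ ∶_) (sym (TL.id-vanishes _)) (here e)
  c .non {x} e with () ← bang-nonlinear (E x) e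

carriesT-bind : {τ : Fin m → Term n} → CarriesT τ E S′ E′ → (s : Slot k) →
                CarriesT (exts τ) (s ∷ᶠ E) (bind S′) (s ∷ᶠ E′)
carriesT-bind c s .lin {zero} e  = var-i (here e)
carriesT-bind c s .lin {suc x} e = ⊩-bind s (c .lin e)
carriesT-bind c s .non {zero} e  = var-i (here (cong bang e)) , s≤s z≤n
carriesT-bind {τ = τ} c s .non {suc x} e =
  bang-∷ (c .non e .proj₁) , subst (_≤ 1) (sym (‖‖-ren suc (τ x) (const 1))) (c .non e .proj₂)

mapsT-bind : {τ : Fin m → Term n} → MapsT τ S S′ → MapsT (exts τ) (bind S) (bind S′)
mapsT-bind ε       = ε
mapsT-bind (m ▸ c) = mapsT-bind m ▸ carriesT-bind c absent

bang-weaken : (s : Slot k) → weakenSlot (bang s) ≡ bang (weakenSlot s)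
bang-weaken absent        = refl
bang-weaken (nonlinear A) = refl
bang-weaken (linear L)    = refl

infix 4 _⊑_

_⊑_ : Frame k n → Frame k n → Set
E ⊑ E′ = ∀ {x} → E x ≢ absent → E′ x ≡ E x

⊩-⊑ : E ⊑ E′ → S ∣ E ⊩ t ∶ A → S ∣ E′ ⊩ t ∶ A
⊩-⊑ {E = E} {E′ = E′} {S = S} e d = subst (_ ∣ _ ⊩ _ ∶_) (TL.id-vanishes _) (⊩-map maps-id c d)
  where
  c : Carries id Ty.id E S E′
  c .lin {x} e′ = carries-id {E = E′} .lin (trans (e λ a → case trans (sym a) e′ of λ ()) e′)
  c .non {x} e′ = carries-id {E = E′} {S = S} .non (trans (e λ a → case trans (sym a) e′ of λ ()) e′)

carriesT-generalise : {τ : Fin m → Term n} → CarriesT τ E S′ E′ →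
                      CarriesT τ (weakenSlot ∘ E) (generalise S′) (weakenSlot ∘ E′)
carriesT-generalise {E = E} c .lin {x} e with weaken-linear (E x) e
... | L , e′ , refl = subst (_ ∣ _ ⊩ _ ∶_) (sym (⌊⌋-weaken L)) (⊩-generalise (c .lin e′))
carriesT-generalise {E = E} {E′ = E′} c .non {x} e with weaken-nonlinear (E x) e
... | A , e′ , refl =
  ⊩-⊑ (λ {y} _ → sym (bang-weaken (E′ y))) (⊩-generalise (c .non e′ .proj₁)) , c .non e′ .proj₂

mapsT-generalise : {τ : Fin m → Term n} → MapsT τ S S′ → MapsT τ (generalise S) (generalise S′)
mapsT-generalise ε       = ε
mapsT-generalise (m ▸ c) = m ▸ c

-- Free variables of typed terms

Live : Stack n k → Frame k n → Fin n → Set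
Live ε             E x = E x ≢ absent
Live (S ▸ D ⟨ θ ⟩) E x = E x ≢ absent ⊎′ Live S D x

live-bind : (S : Stack n k) {s : Slot k} → Live (bind S) (s ∷ᶠ E) (suc x) → Live S E x
live-bind ε             l        = l
live-bind (S ▸ D ⟨ θ ⟩) (inj₁ l) = inj₁ l
live-bind (S ▸ D ⟨ θ ⟩) (inj₂ l) = inj₂ (live-bind S l)

live-generalise : (S : Stack n k) → Live (generalise S) (weakenSlot ∘ E) x → Live S E x
live-generalise ε             l        = l ∘ cong weakenSlot
live-generalise (S ▸ D ⟨ θ ⟩) (inj₁ l) = inj₁ (l ∘ cong weakenSlot)
live-generalise (S ▸ D ⟨ θ ⟩) (inj₂ l) = inj₂ l

live-top : (S : Stack n k) → E x ≢ absent → Live S E x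
live-top ε             l = l
live-top (S ▸ D ⟨ θ ⟩) l = inj₁ l

-- Since environments are not split, this is a coarse bound. It is sharp enough for arguments of
-- `⇒-e`, whose derivations see only `bang ∘ E` at level 0: their free variables are nonlinear in
-- `E`.
free-live : S ∣ E ⊩ t ∶ A → x ∈ᶠ t → Live S E x
free-live {S = S} (var-i (here e)) var  = live-top S λ e′ → case trans (sym e′) e of λ ()
free-live (var-i (below {S = S} e)) var = inj₂ (live-top S λ e′ → case trans (sym e′) e of λ ())
free-live {S = S} (⊸-i d _) (ƛ p)       = live-bind S (free-live d p)
free-live (⊸-e d d′) (·ˡ p)             = free-live d p
free-live (⊸-e d d′) (·ʳ p)             = free-live d′ p
free-live {S = S} (⇒-i d) (ƛ p)         = live-bind S (free-live d p)
free-live (⇒-e d d′ _) (·ˡ p)           = free-live d p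
free-live {S = S} (⇒-e d d′ _) (·ʳ p)   = live-top S (free-live d′ p ∘ cong bang)
free-live (§-i d) p with free-live d p
... | inj₁ l = contradiction refl l
... | inj₂ l = l
free-live (§-e d) p                     = inj₂ (free-live d p)
free-live {S = S} (∀-i d) p             = live-generalise S (free-live d p)
free-live (∀-e d) p                     = free-live d p

⊩-‖‖-mono : {v w : Fin n → ℕ} → S ∣ E ⊩ t ∶ A → (∀ x → Live S E x → v x ≤ w x) → ‖ t ‖ v ≤ ‖ t ‖ w
⊩-‖‖-mono {t = t} d h = ‖‖-mono-∈ t λ x p → h x (free-live d p)

‖exts‖ : (τ : Fin m → Term n) (t : Term (suc m)) → ‖ sub (exts τ) t ‖ (δ zero) ≡ ‖ t ‖ (δ zero)
‖exts‖ τ t = trans (‖‖-sub (exts τ) t (δ zero)) (‖‖-cong t λ where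
  zero    → refl
  (suc x) → trans (‖‖-ren suc (τ x) (δ zero)) (‖‖-0 (τ x)))

⊩-sub : {τ : Fin m → Term n} → MapsT τ S S′ → CarriesT τ E S′ E′ →
        S ∣ E ⊩ t ∶ A → S′ ∣ E′ ⊩ sub τ t ∶ A
⊩-sub m c (var-i (here e)) = c .lin e
⊩-sub (m ▸ c′) c (var-i (below e)) = ⊩-unbox (c′ .non e .proj₁)
⊩-sub {τ = τ} m c (⊸-i {t = t} d q) =
  ⊸-i (⊩-sub (mapsT-bind m) (carriesT-bind c _) d) (subst (_≤ 1) (sym (‖exts‖ τ t)) q)
⊩-sub m c (⊸-e d d′) = ⊸-e (⊩-sub m c d) (⊩-sub m c d′)
⊩-sub m c (⇒-i d) = ⇒-i (⊩-sub (mapsT-bind m) (carriesT-bind c _) d)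
⊩-sub {E = E} {E′ = E′} {τ = τ} m c (⇒-e {u = u} d d′ q) =
  ⇒-e (⊩-sub m c d) (⊩-sub ε c! d′)
    (≤-trans (≤-reflexive (‖‖-sub τ u (const 1))) (≤-trans (⊩-‖‖-mono d′ bound) q))
  where
  c! : CarriesT τ (bang ∘ E) ε (bang ∘ E′)
  c! .lin {x} e with bang-linear (E x) e
  ... | A , e′ , refl = c .non e′ .proj₁
  c! .non {x} e with () ← bang-nonlinear (E x) e
  bound : ∀ x → bang (E x) ≢ absent → ‖ τ x ‖ (const 1) ≤ 1
  bound x l with E x in e
  ... | absent      = contradiction refl l
  ... | nonlinear A = c .non e .proj₂
  ... | linear L    = contradiction refl l
⊩-sub {τ = τ} m c (§-i d) = §-i (⊩-sub (m ▸ c) c∅ d)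
  where
  c∅ : CarriesT τ (const absent) S′ E′
  c∅ .lin ()
  c∅ .non ()
⊩-sub (m ▸ c′) c (§-e d) = §-e (⊩-sub m c′ d)
⊩-sub m c (∀-i d) = ∀-i (⊩-sub (mapsT-generalise m) (carriesT-generalise c) d)
⊩-sub m c (∀-e d) = ∀-e (⊩-sub m c d)

carriesT-∷ : {s : Slot k} →
             (∀ {L} → s ≡ linear L → S ∣ E ⊩ u ∶ ⌊ L ⌋) →
             (∀ {A} → s ≡ nonlinear A → ε ∣ bang ∘ E ⊩ u ∶ A × ‖ u ‖ (const 1) ≤ 1) →
             CarriesT (u ∷ᶠ var) (s ∷ᶠ E) S E
carriesT-∷ h h′ .lin {zero} e  = h e
carriesT-∷ h h′ .lin {suc x} e = var-i (here e)
carriesT-∷ h h′ .non {zero} e  = h′ e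
carriesT-∷ h h′ .non {suc x} e = var-i (here (cong bang e)) , s≤s z≤n

mapsT-∷ : MapsT (u ∷ᶠ var) (bind S) S
mapsT-∷ {S = ε}           = ε
mapsT-∷ {S = S ▸ D ⟨ θ ⟩} = mapsT-∷ ▸ carriesT-∷ (λ ()) (λ ())

-- Inversion of abstractions

-- A derivation of ƛ t can be normalised to end with introduction rules only, as
-- dictated by its type.

data Abs {n k} : Stack n k → Frame k n → Term (suc n) → Type k → Set where
  ⊸ᵃ : bind S ∣ linear (type A) ∷ᶠ E ⊩ t ∶ B → ‖ t ‖ (δ zero) ≤ 1 → Abs S E t (A ⊸ B)
  ⇒ᵃ : bind S ∣ nonlinear A ∷ᶠ E ⊩ t ∶ B → Abs S E t (A ⇒ B)
  §ᵃ : Abs (S ▸ E ⟨ Ty.id ⟩) (const absent) t A → Abs S E t (§ A)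
  ∀ᵃ : Abs (generalise S) (weakenSlot ∘ E) t A → Abs S E t (∀′ A)

ext-id : (t : Term (suc n)) → ren (ext id) t ≡ t
ext-id t = trans (ren-cong (λ { zero → refl ; (suc x) → refl }) t) (ren-id t)

abs-map : Maps id σ S S′ → Carries id σ E S′ E′ → Abs S E t A → Abs S′ E′ t (A / σ)
abs-map {t = t} m c (⊸ᵃ d q) =
  ⊸ᵃ (subst (_ ∣ _ ⊩_∶ _) (ext-id t) (⊩-ren (maps-bind m) (carries-bind c _) d)) q
abs-map {t = t} m c (⇒ᵃ d) =
  ⇒ᵃ (subst (_ ∣ _ ⊩_∶ _) (ext-id t) (⊩-ren (maps-bind m) (carries-bind c _) d))
abs-map m c (§ᵃ a) = §ᵃ (abs-map (m ▸ c ⟨ trans TL.id-⊙ (sym TL.⊙-id) ⟩) carries-absent a)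
abs-map m c (∀ᵃ a) = ∀ᵃ (abs-map (maps-generalise m) (carries-generalise c) a)

carries-instantiate : Carries id (Ty.sub B) (weakenSlot ∘ E) S E
carries-instantiate {E = E} .lin {x} e with weaken-linear (E x) e
... | L , e′ , refl = subst (_ ∣ _ ∋ _ ∶_)
  (sym (trans (cong (_/ Ty.sub _) (⌊⌋-weaken L)) (TL.weaken-sub ⌊ L ⌋))) (here e′)
carries-instantiate {E = E} .non {x} e with weaken-nonlinear (E x) e
... | A , e′ , refl = trans e′ (cong nonlinear (sym (TL.weaken-sub A)))

maps-instantiate : Maps id (Ty.sub B) (generalise S) S
maps-instantiate {S = ε}           = ε
maps-instantiate {S = S ▸ D ⟨ θ ⟩} =
  maps-id ▸ carries-id ⟨ trans TL.map-weaken-⊙-sub (sym TL.id-⊙) ⟩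

-- Each elimination rule meets the introduction found by the induction; the pair is cut by a type
-- substitution (`abs-map`), which leaves the body of the abstraction unchanged.
⊩-abs : S ∣ E ⊩ ƛ t ∶ A → Abs S E t A
⊩-abs (⊸-i d q) = ⊸ᵃ d q
⊩-abs (⇒-i d)   = ⇒ᵃ d
⊩-abs (§-i d)   = §ᵃ (⊩-abs d)
-- The frame entered with `Ty.id` at the introduction is re-entered with the θ of the elimination,
-- which turns `A` into `A / θ`.
⊩-abs (§-e d) with §ᵃ a ← ⊩-abs d = abs-map (maps-id ▸ carries-id ⟨ refl ⟩) carries-absent a
⊩-abs (∀-i d)   = ∀ᵃ (⊩-abs d)
⊩-abs (∀-e d) with ∀ᵃ a ← ⊩-abs d = abs-map maps-instantiate carries-instantiate a

-- Subject reduction for the level calculus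

-- Reduction may multiply occurrences of nonlinear variables, so `⊩-⟶` compares counts only for
-- weights that are zero on these, at every level of the stack.
Vanishing : (Fin n → ℕ) → Stack n k → Frame k n → Set
Vanishing w ε             E = ∀ {x A} → E x ≡ nonlinear A → w x ≡ 0
Vanishing w (S ▸ D ⟨ θ ⟩) E = (∀ {x A} → E x ≡ nonlinear A → w x ≡ 0) × Vanishing w S D

vanishing-top : {w : Fin n → ℕ} (S : Stack n k) → Vanishing w S E →
                ∀ {x A} → E x ≡ nonlinear A → w x ≡ 0
vanishing-top ε             h = h
vanishing-top (S ▸ D ⟨ θ ⟩) h = h .proj₁

vanishing-bind : {w : Fin n → ℕ} {s : Slot k} (S : Stack n k) →
                 Vanishing w S E → Vanishing (0 ∷ᶠ w) (bind S) (s ∷ᶠ E)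
vanishing-bind ε h {zero}  _ = refl
vanishing-bind ε h {suc x} e = h e
vanishing-bind (S ▸ D ⟨ θ ⟩) (h , h′) = (λ { {zero} _ → refl ; {suc x} e → h e }) , vanishing-bind S h′

vanishing-δ : (S : Stack n k) → Vanishing (δ zero) (bind S) (linear L ∷ᶠ E)
vanishing-δ ε {suc x} e = refl
vanishing-δ (S ▸ D ⟨ θ ⟩) = (λ { {suc x} e → refl }) , below-δ S
  where
  below-δ : (S : Stack n k) → Vanishing (δ zero) (bind S) (absent ∷ᶠ E)
  below-δ ε {suc x} e = refl
  below-δ (S ▸ D ⟨ θ ⟩) = (λ { {suc x} e → refl }) , below-δ S

vanishing-generalise : {w : Fin n → ℕ} (S : Stack n k) →
                       Vanishing w S E → Vanishing w (generalise S) (weakenSlot ∘ E)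
vanishing-generalise {E = E} ε h {x} e = h (weaken-nonlinear (E x) e .proj₂ .proj₁)
vanishing-generalise {E = E} (S ▸ D ⟨ θ ⟩) (h , h′) =
  (λ {x} e → h (weaken-nonlinear (E x) e .proj₂ .proj₁)) , h′

‖[]‖ : (t : Term (suc n)) (u : Term n) (w : Fin n → ℕ) →
       ‖ sub (u ∷ᶠ var) t ‖ w ≡ ‖ u ‖ w * ‖ t ‖ (δ zero) + ‖ t ‖ (0 ∷ᶠ w)
‖[]‖ t u w = trans (‖‖-sub (u ∷ᶠ var) t w)
  (trans (‖‖-cong t λ { zero → refl ; (suc x) → refl }) (‖‖-∷ t (‖ u ‖ w) w))

-- A redex may duplicate its argument, but only when the argument is banged,
-- so that all its variables are nonlinear.

⊩-⟶ : S ∣ E ⊩ t ∶ A → t ⟶ u →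
       S ∣ E ⊩ u ∶ A × (∀ w → Vanishing w S E → ‖ u ‖ w ≤ ‖ t ‖ w)
⊩-⟶ (var-i _) ()
⊩-⟶ {S = S} (⊸-i d q) (ξ r) with d′ , le ← ⊩-⟶ d r =
  -- The bound for the weight `δ zero` restores the side condition of `⊸-i`; hence typing and bounds
  -- are proved together.
  ⊸-i d′ (≤-trans (le (δ zero) (vanishing-δ S)) q) , λ w h → le (0 ∷ᶠ w) (vanishing-bind S h)
⊩-⟶ {S = S} (⇒-i d) (ξ r) with d′ , le ← ⊩-⟶ d r =
  ⇒-i d′ , λ w h → le (0 ∷ᶠ w) (vanishing-bind S h)
⊩-⟶ (⊸-e d e) (β {t} {u}) with ⊸ᵃ d′ q ← ⊩-abs d =
  subst (_ ∣ _ ⊩_∶ _) (sym ([]≡sub t u))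
    (⊩-sub mapsT-∷ (carriesT-∷ (λ { refl → e }) (λ ())) d′) ,
  λ w h → begin
    ‖ t [ u ] ‖ w                                ≡⟨ cong (λ t → ‖ t ‖ w) ([]≡sub t u) ⟩
    ‖ sub (u ∷ᶠ var) t ‖ w                       ≡⟨ ‖[]‖ t u w ⟩
    ‖ u ‖ w * ‖ t ‖ (δ zero) + ‖ t ‖ (0 ∷ᶠ w)    ≤⟨ +-monoˡ-≤ _ (*-monoʳ-≤ (‖ u ‖ w) q) ⟩
    ‖ u ‖ w * 1 + ‖ t ‖ (0 ∷ᶠ w)                 ≡⟨ cong (_+ _) (*-identityʳ (‖ u ‖ w)) ⟩
    ‖ u ‖ w + ‖ t ‖ (0 ∷ᶠ w)                     ≡⟨ +-comm (‖ u ‖ w) _ ⟩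
    ‖ t ‖ (0 ∷ᶠ w) + ‖ u ‖ w                     ∎
  where open ≤-Reasoning
⊩-⟶ {S = S} {E = E} (⇒-e d e q) (β {t} {u}) with ⇒ᵃ d′ ← ⊩-abs d =
  subst (_ ∣ _ ⊩_∶ _) (sym ([]≡sub t u))
    (⊩-sub mapsT-∷ (carriesT-∷ (λ ()) (λ { refl → e , q })) d′) ,
  λ w h → begin
    ‖ t [ u ] ‖ w                                ≡⟨ cong (λ t → ‖ t ‖ w) ([]≡sub t u) ⟩
    ‖ sub (u ∷ᶠ var) t ‖ w                       ≡⟨ ‖[]‖ t u w ⟩
    ‖ u ‖ w * ‖ t ‖ (δ zero) + ‖ t ‖ (0 ∷ᶠ w)    ≡⟨ cong (λ c → c * ‖ t ‖ (δ zero) + _) (unused w h) ⟩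
    ‖ t ‖ (0 ∷ᶠ w)                               ≤⟨ m≤m+n _ _ ⟩
    ‖ t ‖ (0 ∷ᶠ w) + ‖ u ‖ w                     ∎
  where
  open ≤-Reasoning
  unused : ∀ w → Vanishing w S E → ‖ u ‖ w ≡ 0
  unused w h = n≤0⇒n≡0 (≤-trans (⊩-‖‖-mono e zero-weight) (≤-reflexive (‖‖-0 u)))
    where
    zero-weight : ∀ x → bang (E x) ≢ absent → w x ≤ 0
    zero-weight x l with E x in e
    ... | absent      = contradiction refl l
    ... | nonlinear A = ≤-reflexive (vanishing-top S h e)
    ... | linear L    = contradiction refl l
⊩-⟶ (⊸-e d e) (·ˡ r) with d′ , le ← ⊩-⟶ d r = ⊸-e d′ e , λ w h → +-monoˡ-≤ _ (le w h)
⊩-⟶ (⊸-e d e) (·ʳ r) with e′ , le ← ⊩-⟶ e r = ⊸-e d e′ , λ w h → +-monoʳ-≤ _ (le w h)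
⊩-⟶ (⇒-e d e q) (·ˡ r) with d′ , le ← ⊩-⟶ d r = ⇒-e d′ e q , λ w h → +-monoˡ-≤ _ (le w h)
⊩-⟶ {E = E} (⇒-e d e q) (·ʳ r) with e′ , le ← ⊩-⟶ e r =
  -- No slot of `bang ∘ E` is nonlinear, so every weight is admissible there, `const 1` included.
  ⇒-e d e′ (≤-trans (le (const 1) (banged {const 1})) q) , λ w h → +-monoʳ-≤ _ (le w (banged {w}))
  where
  banged : ∀ {w} → Vanishing w ε (bang ∘ E)
  banged {x = x} e = contradiction e (bang-nonlinear (E x))
⊩-⟶ (§-i d) r with d′ , le ← ⊩-⟶ d r = §-i d′ , λ w h → le w ((λ ()) , h)
⊩-⟶ (§-e d) r with d′ , le ← ⊩-⟶ d r = §-e d′ , λ w h → le w (h .proj₂)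
⊩-⟶ {S = S} (∀-i d) r with d′ , le ← ⊩-⟶ d r = ∀-i d′ , λ w h → le w (vanishing-generalise S h)
⊩-⟶ (∀-e d) r with d′ , le ← ⊩-⟶ d r = ∀-e d′ , le

-- From DLAL to the level calculus

⊎-lookup : ∀ {Γ : Env k n} → Γ₁ ⊎ Γ₂ ≔ Γ → ∀ x →
           (lookup Γ₁ x ≡ lookup Γ x × lookup Γ₂ x ≡ absent) ⊎′
           (lookup Γ₁ x ≡ absent × lookup Γ₂ x ≡ lookup Γ x)
⊎-lookup (left ∷ p)  zero    = inj₁ (refl , refl)
⊎-lookup (right ∷ p) zero    = inj₂ (refl , refl)
⊎-lookup (_ ∷ p)     (suc x) = ⊎-lookup p x

⊎-⊑ˡ : ∀ {Γ : Env k n} → Γ₁ ⊎ Γ₂ ≔ Γ → lookup Γ₁ ⊑ lookup Γ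
⊎-⊑ˡ p {x} l with ⊎-lookup p x
... | inj₁ (e , _) = sym e
... | inj₂ (e , _) = contradiction e l

⊎-⊑ʳ : ∀ {Γ : Env k n} → Γ₁ ⊎ Γ₂ ≔ Γ → lookup Γ₂ ⊑ lookup Γ
⊎-⊑ʳ p {x} l with ⊎-lookup p x
... | inj₁ (_ , e) = contradiction e l
... | inj₂ (_ , e) = sym e

lookup-↦ : (x : Fin n) (s : Slot k) → lookup (x ↦ s) x ≡ s
lookup-↦ x s = lookup∘update x ∅ s

lookup-↦-≢ : x ≢ y → (s : Slot k) → lookup (y ↦ s) x ≡ absent
lookup-↦-≢ {x = x} x≢y s = trans (lookup∘update′ x≢y ∅ s) (lookup-replicate x absent)

↦-live : (x y : Fin n) {s : Slot k} → lookup (y ↦ s) x ≢ absent → x ≡ y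
↦-live x y {s} l with x ≟ y
... | yes e = e
... | no ¬e = contradiction (lookup-↦-≢ ¬e s) l

∷-lookup : ∀ {E : Env k n} → lookup (s ∷ E) ⊑ s ∷ᶠ lookup E
∷-lookup {x = zero}  _ = refl
∷-lookup {x = suc x} _ = refl

δ-refl : (x : Fin n) → δ x x ≡ 1
δ-refl zero    = refl
δ-refl (suc x) = δ-refl x

δ-≢ : {x y : Fin n} → x ≢ y → δ x y ≡ 0
δ-≢ {x = zero}  {zero}  ne = contradiction refl ne
δ-≢ {x = zero}  {suc y} ne = refl
δ-≢ {x = suc x} {zero}  ne = refl
δ-≢ {x = suc x} {suc y} ne = δ-≢ (ne ∘ cong suc)

δ-≤1 : (x y : Fin n) → δ x y ≤ 1
δ-≤1 x y with x ≟ y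
... | yes refl = ≤-reflexive (δ-refl x)
... | no  ne   = ≤-trans (≤-reflexive (δ-≢ {x = x} {y} ne)) z≤n

⊩-dead : {E : Frame k n} → ε ∣ E ⊩ t ∶ A → E x ≡ absent → ‖ t ‖ (δ x) ≡ 0
⊩-dead {t = t} {x = x} d e = n≤0⇒n≡0 (≤-trans
  (⊩-‖‖-mono d λ y l → ≤-reflexive (δ-≢ {x = x} {y} λ { refl → l e }))
  (≤-reflexive (‖‖-0 t)))

Affine : Term n → Frame k n → Set
Affine t E = ∀ {x L} → E x ≡ linear L → ‖ t ‖ (δ x) ≤ 1

≤1-resp : {a b : ℕ} → a ≡ b → b ≤ 1 → a ≤ 1
≤1-resp e = ≤-trans (≤-reflexive e)

⇝-inv : {s s′ : Slot k} {L : Formula k} → s ⇝§ s′ → s ≡ linear L →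
        ∃[ A ] L ≡ type A × (s′ ≡ nonlinear A ⊎′ s′ ≡ linear [ A ]§)
⇝-inv nonlinear refl = _ , refl , inj₁ refl
⇝-inv discharge refl = _ , refl , inj₂ refl

⇝-linear : {s s′ : Slot k} {L : Formula k} → s ⇝§ s′ → s′ ≡ linear L → ∃[ L′ ] s ≡ linear L′
⇝-linear discharge refl = _ , refl

⇝-nonlinear : {s s′ : Slot k} {A : Type k} → s ⇝§ s′ → s ≢ nonlinear A
⇝-nonlinear absent    ()
⇝-nonlinear nonlinear ()
⇝-nonlinear discharge ()

≢absent : {s s′ : Slot k} → s ≡ s′ → s′ ≢ absent → s ≢ absent
≢absent refl l = l

-- `Affine` is part of the induction because it becomes the side condition of `⊸-i` once the
-- variable is bound; the level judgement does not record it for free variables.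
⊢⇒⊩ : {E : Env k n} → E ⊢ t ∶ A → ε ∣ lookup E ⊩ t ∶ A × Affine t (lookup E)
⊢⇒⊩ (Id {x} {A}) = var-i (here (lookup-↦ x _)) , λ {y} _ → δ-≤1 y x
⊢⇒⊩ (⊸-i d) with d′ , a ← ⊢⇒⊩ d =
  ⊸-i (⊩-⊑ (λ {x} → ∷-lookup {x = x}) d′) (a {zero} refl) , λ {x} e → a {suc x} e
⊢⇒⊩ (⊸-e {t = t} {u} d₁ d₂ p) with d₁′ , a₁ ← ⊢⇒⊩ d₁ | d₂′ , a₂ ← ⊢⇒⊩ d₂ =
  ⊸-e (⊩-⊑ (⊎-⊑ˡ p) d₁′) (⊩-⊑ (⊎-⊑ʳ p) d₂′) , affine
  where
  affine : Affine (t · u) _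
  affine {x} e with ⊎-lookup p x
  ... | inj₁ (e₁ , e₂) =
    ≤1-resp (trans (cong (‖ t ‖ (δ x) +_) (⊩-dead d₂′ e₂)) (+-identityʳ _)) (a₁ (trans e₁ e))
  ... | inj₂ (e₁ , e₂) = ≤1-resp (cong (_+ ‖ u ‖ (δ x)) (⊩-dead d₁′ e₁)) (a₂ (trans e₂ e))
⊢⇒⊩ (⇒-i d) with d′ , a ← ⊢⇒⊩ d =
  ⇒-i (⊩-⊑ (λ {x} → ∷-lookup {x = x}) d′) , λ {x} e → a {suc x} e
⊢⇒⊩ {E = E} (⇒-e {t = t} {u} {z} {C = C} d₁ d₂ p)
  with d₁′ , a₁ ← ⊢⇒⊩ d₁ | d₂′ , a₂ ← ⊢⇒⊩ d₂ =
  ⇒-e (⊩-⊑ (⊎-⊑ˡ p) d₁′) (⊩-⊑ banged d₂′)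
    -- Only `z` can occur in `u`, so the count of all occurrences is at most that of `z`, which is
    -- linear in the premise.
    (≤-trans (⊩-‖‖-mono d₂′ only-z) (a₂ (lookup-↦ z _))) , affine
  where
  z∈E : lookup E z ≡ nonlinear C
  z∈E = trans (⊎-⊑ʳ p (≢absent (lookup-↦ z _) λ ())) (lookup-↦ z _)
  banged : lookup (z ↦ linear (type C)) ⊑ bang ∘ lookup E
  banged {x} l with refl ← ↦-live x z l = trans (cong bang z∈E) (sym (lookup-↦ z _))
  only-z : ∀ x → lookup (z ↦ linear (type C)) x ≢ absent → 1 ≤ δ z x
  only-z x l with refl ← ↦-live x z l = ≤-reflexive (sym (δ-refl z))
  affine : Affine (t · u) _
  affine {x} e =
    ≤1-resp (trans (cong (‖ t ‖ (δ x) +_) (⊩-dead d₂′ (lookup-↦-≢ x≢z _))) (+-identityʳ _)) x∈E₁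
    where
    x≢z : x ≢ z
    x≢z refl = case trans (sym e) z∈E of λ ()
    x∈E₁ : ‖ t ‖ (δ x) ≤ 1
    x∈E₁ with ⊎-lookup p x
    ... | inj₁ (e₁ , _) = a₁ (trans e₁ e)
    ... | inj₂ (e₁ , _) = ≤1-resp (⊩-dead d₁′ e₁) z≤n
⊢⇒⊩ {E = E} (⇒-e∅ {t = t} {u} d₁ d₂) with d₁′ , a₁ ← ⊢⇒⊩ d₁ | d₂′ , a₂ ← ⊢⇒⊩ d₂ =
  ⇒-e d₁′ (⊩-⊑ (λ {x} l → contradiction (lookup-replicate x absent) l) d₂′) (≤1-resp closed z≤n) ,
  λ {x} e → ≤1-resp
    (trans (cong (‖ t ‖ (δ x) +_) (⊩-dead d₂′ (lookup-replicate x absent))) (+-identityʳ _)) (a₁ e)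
  where
  closed : ‖ u ‖ (const 1) ≡ 0
  closed = n≤0⇒n≡0 (≤-trans
    (⊩-‖‖-mono d₂′ λ x l → contradiction (lookup-replicate x absent) l)
    (≤-reflexive (‖‖-0 u)))
⊢⇒⊩ (Weak {t = t} d p) with d′ , a ← ⊢⇒⊩ d = ⊩-⊑ (⊎-⊑ˡ p) d′ , affine
  where
  affine : Affine t _
  affine {x} e with ⊎-lookup p x
  ... | inj₁ (e₁ , _) = a (trans e₁ e)
  ... | inj₂ (e₁ , _) = ≤1-resp (⊩-dead d′ e₁) z≤n
⊢⇒⊩ {n = n} {E = E} (Cntr {E₁} {t = t} {x} {A} d p) with d′ , a ← ⊢⇒⊩ d =
  subst (_ ∣ _ ⊩_∶ _) (sym (contract≡sub x t)) (⊩-sub ε c d′) , affine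
  where
  τ : Fin (suc (suc n)) → Term n
  τ = var x ∷ᶠ var x ∷ᶠ var
  x∈E : lookup E x ≡ nonlinear A
  x∈E = trans (⊎-⊑ʳ p (≢absent (lookup-↦ x _) λ ())) (lookup-↦ x _)
  x∈! : ε ∣ bang ∘ lookup E ⊩ var x ∶ A × 1 ≤ 1
  x∈! = var-i (here (cong bang x∈E)) , s≤s z≤n
  inE : ∀ {y s} → lookup E₁ y ≡ s → s ≢ absent → lookup E y ≡ s
  inE e l = trans (⊎-⊑ˡ p (≢absent e l)) e
  c : CarriesT τ (lookup (nonlinear A ∷ nonlinear A ∷ E₁)) ε (lookup E)
  c .lin {suc (suc y)} e = var-i (here (inE e λ ()))
  c .non {zero} refl     = x∈!
  c .non {suc zero} refl = x∈!
  c .non {suc (suc y)} e = var-i (here (cong bang (inE e λ ()))) , s≤s z≤n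
  affine : Affine (contract x t) _
  affine {y} e = ≤1-resp
    (trans (cong (λ t → ‖ t ‖ (δ y)) (contract≡sub x t))
           (trans (‖‖-sub τ t (δ y)) (‖‖-cong t weights)))
    y∈E₁
    where
    y≢x : y ≢ x
    y≢x refl = case trans (sym e) x∈E of λ ()
    weights : (λ z → ‖ τ z ‖ (δ y)) ≗ δ (suc (suc y))
    weights zero          = δ-≢ y≢x
    weights (suc zero)    = δ-≢ y≢x
    weights (suc (suc z)) = refl
    y∈E₁ : ‖ t ‖ (δ (suc (suc y))) ≤ 1
    y∈E₁ with ⊎-lookup p y
    ... | inj₁ (e₁ , _) = a {suc (suc y)} (trans e₁ e)
    ... | inj₂ (e₁ , _) = ≤1-resp (⊩-dead {x = suc (suc y)} d′ e₁) z≤n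
⊢⇒⊩ {E = E} (§-i {E′} {t = t} d ps) with d′ , a ← ⊢⇒⊩ d =
  -- The term stays the same while its variables are retyped: those becoming nonlinear are read from
  -- the frame below, the discharged ones are popped with `§-e`. The latter is more than a variable
  -- lookup, hence a substitution by `var` and not a renaming.
  §-i (subst (_ ∣ _ ⊩_∶ _) (sub-var t) (⊩-sub ε c d′)) ,
  λ {x} e → a (⇝-linear (Pointwise.lookup ps x) e .proj₂)
  where
  c : CarriesT var (lookup E′) (ε ▸ lookup E ⟨ Ty.id ⟩) (const absent)
  c .lin {x} e with ⇝-inv (Pointwise.lookup ps x) e
  ... | A , refl , inj₁ e′ = subst (_ ∣ _ ⊩ _ ∶_) (TL.id-vanishes A) (var-i (below e′))
  ... | A , refl , inj₂ e′ = subst (_ ∣ _ ⊩ _ ∶_) (TL.id-vanishes A) (§-e (var-i (here e′)))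
  c .non {x} e = contradiction e (⇝-nonlinear (Pointwise.lookup ps x))
⊢⇒⊩ {E = E} (§-e {E₁} {E₂} {t = t} {u} {A} d₁ d₂ p) with d₁′ , a₁ ← ⊢⇒⊩ d₁ | d₂′ , a₂ ← ⊢⇒⊩ d₂ =
  subst (_ ∣ _ ⊩_∶ _) (sym ([]≡sub t u)) (⊩-sub ε c d₂′) , affine
  where
  inE : ∀ {y s} → lookup E₂ y ≡ s → s ≢ absent → lookup E y ≡ s
  inE e l = trans (⊎-⊑ʳ p (≢absent e l)) e
  c : CarriesT (u ∷ᶠ var) (lookup (linear [ A ]§ ∷ E₂)) ε (lookup E)
  c .lin {zero} refl = ⊩-⊑ (⊎-⊑ˡ p) d₁′
  c .lin {suc y} e   = var-i (here (inE e λ ()))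
  c .non {suc y} e   = var-i (here (cong bang (inE e λ ()))) , s≤s z≤n
  affine : Affine (t [ u ]) _
  affine {x} e = ≤1-resp
    (trans (cong (λ t → ‖ t ‖ (δ x)) ([]≡sub t u)) (‖[]‖ t u (δ x))) bound
    where
    bound : ‖ u ‖ (δ x) * ‖ t ‖ (δ zero) + ‖ t ‖ (δ (suc x)) ≤ 1
    bound with ⊎-lookup p x
    -- The occurrences of `x` in `u` are multiplied by those of the discharged variable in `t`; both
    -- numbers are at most one.
    ... | inj₁ (e₁ , e₂) = ≤1-resp
      (trans (cong (‖ u ‖ (δ x) * ‖ t ‖ (δ zero) +_) (⊩-dead {x = suc x} d₂′ e₂)) (+-identityʳ _))
      (*-mono-≤ (a₁ (trans e₁ e)) (a₂ {zero} refl))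
    ... | inj₂ (e₁ , e₂) = ≤1-resp
      (cong (λ c → c * ‖ t ‖ (δ zero) + _) (⊩-dead d₁′ e₁)) (a₂ {suc x} (trans e₂ e))
⊢⇒⊩ {E = E} (∀-i d) with d′ , a ← ⊢⇒⊩ d =
  ∀-i (⊩-⊑ (λ {x} _ → sym (lookup-map x weakenSlot E)) d′) ,
  λ {x} e → a (trans (lookup-map x weakenSlot E) (cong weakenSlot e))
⊢⇒⊩ (∀-e d) with d′ , a ← ⊢⇒⊩ d = ∀-e d′ , a

-- Structural rules of DLAL

≗⇒≡ : {Γ Γ′ : Env k n} → lookup Γ ≗ lookup Γ′ → Γ ≡ Γ′
≗⇒≡ {Γ = Γ} {Γ′} e = trans (sym (tabulate∘lookup Γ)) (trans (tabulate-cong e) (tabulate∘lookup Γ′))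

⊢-cong : Γ ≡ Γ′ → Γ ⊢ t ∶ A → Γ′ ⊢ t ∶ A
⊢-cong refl d = d

⊎-∀ : (∀ x → lookup Γ₁ x ⊎ˢ lookup Γ₂ x ≔ lookup Γ x) → Γ₁ ⊎ Γ₂ ≔ Γ
⊎-∀ {Γ₁ = []}    {[]}    {[]}    f = []
⊎-∀ {Γ₁ = _ ∷ _} {_ ∷ _} {_ ∷ _} f = f zero ∷ ⊎-∀ (f ∘ suc)

⊎-lookupˢ : Γ₁ ⊎ Γ₂ ≔ Γ → ∀ x → lookup Γ₁ x ⊎ˢ lookup Γ₂ x ≔ lookup Γ x
⊎-lookupˢ (p ∷ ps) zero    = p
⊎-lookupˢ (p ∷ ps) (suc x) = ⊎-lookupˢ ps x

left-≡ : {s₁ s₂ s : Slot k} → s₁ ≡ s → s₂ ≡ absent → s₁ ⊎ˢ s₂ ≔ s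
left-≡ refl refl = left

right-≡ : {s₁ s₂ s : Slot k} → s₁ ≡ absent → s₂ ≡ s → s₁ ⊎ˢ s₂ ≔ s
right-≡ refl refl = right

⊢-⊑ : Γ ⊢ t ∶ A → lookup Γ ⊑ lookup Γ′ → Γ′ ⊢ t ∶ A
⊢-⊑ {Γ = Γ} {Γ′ = Γ′} d e = Weak d (⊎-∀ {Γ₂ = tabulate λ x → rest (lookup Γ x) (lookup Γ′ x)} split)
  where
  rest : Slot _ → Slot _ → Slot _
  rest absent s = s
  rest _      _ = absent
  split : ∀ x → lookup Γ x ⊎ˢ lookup (tabulate λ x → rest (lookup Γ x) (lookup Γ′ x)) x ≔ lookup Γ′ x
  split x rewrite lookup∘tabulate (λ x → rest (lookup Γ x) (lookup Γ′ x)) x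
    with lookup Γ x in eq
  ... | absent      = right
  ... | nonlinear A = left-≡ (sym (trans (e (≢absent eq λ ())) eq)) refl
  ... | linear F    = left-≡ (sym (trans (e (≢absent eq λ ())) eq)) refl

sub-[] : (τ : Fin m → Term n) (t : Term (suc m)) (u : Term m) →
         sub τ (t [ u ]) ≡ sub (exts τ) t [ sub τ u ]
sub-[] τ t u = trans (cong (sub τ) ([]≡sub t u)) (trans (sub-sub τ (u ∷ᶠ var) t)
  (sym (trans ([]≡sub (sub (exts τ) t) (sub τ u)) (trans (sub-sub (sub τ u ∷ᶠ var) (exts τ) t)
    (sub-cong (λ { zero → refl ; (suc x) → trans (sub-ren _ suc (τ x)) (sub-var (τ x)) }) t)))))

sub-contract : (τ : Fin m → Term n) {x : Fin m} {y : Fin n} → τ x ≡ var y → (t : Term (suc (suc m))) →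
               sub τ (contract x t) ≡ contract y (sub (exts (exts τ)) t)
sub-contract τ {x} {y} e t = trans (cong (sub τ) (contract≡sub x t)) (trans (sub-sub τ _ t)
  (sym (trans (contract≡sub y (sub (exts (exts τ)) t)) (trans (sub-sub _ (exts (exts τ)) t)
    (sub-cong (λ { zero → sym e ; (suc zero) → sym e
                 ; (suc (suc z)) → trans (sub-ren _ suc (ren suc (τ z)))
                     (trans (sub-ren _ suc (τ z)) (sub-var (τ z))) }) t)))))

-- A relocation moves the variables declared in an environment injectively and
-- replaces the others by arbitrary terms; ρ is the partial inverse of the move.

Inverse : (Fin m → Term n) → (Fin n → Maybe (Fin m)) → Set
Inverse τ ρ = ∀ {x y} → ρ x ≡ just y → τ y ≡ var x

Reaches : (Fin n → Maybe (Fin m)) → Env k m → Set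
Reaches ρ Γ = ∀ {y} → lookup Γ y ≢ absent → ∃[ x ] ρ x ≡ just y

move : (Fin n → Maybe (Fin m)) → Env k m → Env k n
move ρ Γ = tabulate λ x → maybe′ (lookup Γ) absent (ρ x)

lookup-move : (ρ : Fin n → Maybe (Fin m)) (Γ : Env k m) (x : Fin n) →
              lookup (move ρ Γ) x ≡ maybe′ (lookup Γ) absent (ρ x)
lookup-move ρ Γ = lookup∘tabulate _

lift : (Fin n → Maybe (Fin m)) → Fin (suc n) → Maybe (Fin (suc m))
lift ρ = just zero ∷ᶠ Maybe.map suc ∘ ρ

lift-inverse : {τ : Fin m → Term n} {ρ : Fin n → Maybe (Fin m)} → Inverse τ ρ → Inverse (exts τ) (lift ρ)
lift-inverse i {zero} refl = refl
lift-inverse {ρ = ρ} i {suc x} e with ρ x in eq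
lift-inverse i {suc x} refl | just y = cong (ren suc) (i eq)

lift-reaches : {ρ : Fin n → Maybe (Fin m)} → Reaches ρ Γ → Reaches (lift ρ) (s ∷ Γ)
lift-reaches r {zero}  l = zero , refl
lift-reaches r {suc y} l with x , e ← r l = suc x , cong (Maybe.map suc) e

move-lift : (ρ : Fin n → Maybe (Fin m)) (Γ : Env k m) → move (lift ρ) (s ∷ Γ) ≡ s ∷ move ρ Γ
move-lift {s = s} ρ Γ = cong (s ∷_) (tabulate-cong λ x → lemma (ρ x))
  where
  lemma : ∀ y → maybe′ (lookup (s ∷ Γ)) absent (Maybe.map suc y) ≡ maybe′ (lookup Γ) absent y
  lemma (just y) = refl
  lemma nothing  = refl

move-⊎ : (ρ : Fin n → Maybe (Fin m)) → Γ₁ ⊎ Γ₂ ≔ Γ → move ρ Γ₁ ⊎ move ρ Γ₂ ≔ move ρ Γ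
move-⊎ {Γ₁ = Γ₁} {Γ₂ = Γ₂} {Γ = Γ} ρ p = ⊎-∀ split
  where
  split : ∀ x → lookup (move ρ Γ₁) x ⊎ˢ lookup (move ρ Γ₂) x ≔ lookup (move ρ Γ) x
  split x rewrite lookup-move ρ Γ₁ x | lookup-move ρ Γ₂ x | lookup-move ρ Γ x with ρ x
  ... | just y  = ⊎-lookupˢ p y
  ... | nothing = left

move-↦ : {τ : Fin m → Term n} (ρ : Fin n → Maybe (Fin m)) → Inverse τ ρ →
         ρ x ≡ just y → (s : Slot k) → move ρ (y ↦ s) ≡ x ↦ s
move-↦ {x = x} {y = y} {τ = τ} ρ i e s = ≗⇒≡ λ z → trans (lookup-move ρ (y ↦ s) z) (lemma z)
  where
  lemma : ∀ z → maybe′ (lookup (y ↦ s)) absent (ρ z) ≡ lookup (x ↦ s) z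
  lemma z with z ≟ x
  ... | yes refl rewrite e = trans (lookup-↦ y s) (sym (lookup-↦ x s))
  ... | no z≢x with ρ z in eq
  ...   | nothing = sym (lookup-↦-≢ z≢x s)
  ...   | just y′ = trans (lookup-↦-≢ y′≢y s) (sym (lookup-↦-≢ z≢x s))
    where
    y′≢y : y′ ≢ y
    y′≢y refl = z≢x (case trans (sym (i eq)) (i e) of λ { refl → refl })

move-∅ : (ρ : Fin n → Maybe (Fin m)) → move {k = k} ρ ∅ ≡ ∅
move-∅ ρ = ≗⇒≡ λ x → trans (lookup-move ρ ∅ x) (trans (lemma (ρ x)) (sym (lookup-replicate x absent)))
  where
  lemma : ∀ y → maybe′ (lookup ∅) absent y ≡ absent
  lemma (just y) = lookup-replicate y absent
  lemma nothing  = refl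

move-⇝ : (ρ : Fin n → Maybe (Fin m)) → Pointwise _⇝§_ Γ′ Γ → Pointwise _⇝§_ (move ρ Γ′) (move ρ Γ)
move-⇝ {Γ′ = Γ′} {Γ = Γ} ρ p = Pointwise.tabulate⁺ λ x → lemma (ρ x)
  where
  lemma : ∀ y → maybe′ (lookup Γ′) absent y ⇝§ maybe′ (lookup Γ) absent y
  lemma (just y) = Pointwise.lookup p y
  lemma nothing  = absent

move-weaken : (ρ : Fin n → Maybe (Fin m)) (Γ : Env k m) → move ρ (weakenEnv Γ) ≡ weakenEnv (move ρ Γ)
move-weaken ρ Γ = ≗⇒≡ λ x → trans (lookup-move ρ (weakenEnv Γ) x) (trans (lemma (ρ x))
  (sym (trans (lookup-map x weakenSlot (move ρ Γ)) (cong weakenSlot (lookup-move ρ Γ x)))))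
  where
  lemma : ∀ y → maybe′ (lookup (weakenEnv Γ)) absent y ≡ weakenSlot (maybe′ (lookup Γ) absent y)
  lemma (just y) = lookup-map y weakenSlot Γ
  lemma nothing  = refl

reaches-ˡ : {ρ : Fin n → Maybe (Fin m)} → Γ₁ ⊎ Γ₂ ≔ Γ → Reaches ρ Γ → Reaches ρ Γ₁
reaches-ˡ p r l = r (≢absent (⊎-⊑ˡ p l) l)

reaches-ʳ : {ρ : Fin n → Maybe (Fin m)} → Γ₁ ⊎ Γ₂ ≔ Γ → Reaches ρ Γ → Reaches ρ Γ₂
reaches-ʳ p r l = r (≢absent (⊎-⊑ʳ p l) l)

⊢-lift : (ρ : Fin n → Maybe (Fin m)) (Γ : Env k m) →
         move (lift ρ) (s ∷ Γ) ⊢ t ∶ A → s ∷ move ρ Γ ⊢ t ∶ A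
⊢-lift ρ Γ = ⊢-cong (move-lift ρ Γ)

⇝-absent : {s s′ : Slot k} → s ⇝§ s′ → s′ ≡ absent → s ≡ absent
⇝-absent absent refl = refl

-- Undeclared variables may have any image: a typable term does not contain them, and this form
-- avoids having to prove so. `Reaches` supplies the new position of each variable that a rule
-- names.
relocate : {τ : Fin m → Term n} {ρ : Fin n → Maybe (Fin m)} → Inverse τ ρ → Reaches ρ Γ →
           Γ ⊢ t ∶ A → move ρ Γ ⊢ sub τ t ∶ A
relocate {ρ = ρ} i r (Id {x} {A}) with z , e ← r (≢absent (lookup-↦ x (linear (type A))) λ ())
  rewrite i e | move-↦ ρ i e (linear (type A)) = Id
relocate {Γ = Γ} {ρ = ρ} i r (⊸-i d) =
  ⊸-i (⊢-lift ρ Γ (relocate (lift-inverse i) (lift-reaches {Γ = Γ} r) d))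
relocate {ρ = ρ} i r (⊸-e d₁ d₂ p) =
  ⊸-e (relocate i (reaches-ˡ p r) d₁) (relocate i (reaches-ʳ p r) d₂) (move-⊎ ρ p)
relocate {Γ = Γ} {ρ = ρ} i r (⇒-i d) =
  ⇒-i (⊢-lift ρ Γ (relocate (lift-inverse i) (lift-reaches {Γ = Γ} r) d))
relocate {ρ = ρ} i r (⇒-e {z = z} {C = C} d₁ d₂ p)
  with x , e ← r (≢absent (⊎-⊑ʳ p {z} (≢absent (lookup-↦ z _) λ ())) (≢absent (lookup-↦ z _) λ ())) =
  ⇒-e (relocate i (reaches-ˡ p r) d₁)
      (⊢-cong (move-↦ ρ i e _)
        (relocate i (λ {y} l → x , trans e (cong just (sym (↦-live y z l)))) d₂))
      (subst (_ ⊎_≔ _) (move-↦ ρ i e _) (move-⊎ ρ p))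
relocate {ρ = ρ} i r (⇒-e∅ d₁ d₂) =
  ⇒-e∅ (relocate i r d₁) (⊢-cong (move-∅ ρ)
    (relocate i (λ {y} l → contradiction (lookup-replicate y absent) l) d₂))
relocate {ρ = ρ} i r (Weak d p) = Weak (relocate i (reaches-ˡ p r) d) (move-⊎ ρ p)
relocate {τ = τ} {ρ = ρ} i r (Cntr {Γ₁} {t = t} {x} {A} d p)
  with y , e ← r (≢absent (⊎-⊑ʳ p {x} (≢absent (lookup-↦ x _) λ ())) (≢absent (lookup-↦ x _) λ ()))
  rewrite sub-contract τ (i e) t =
  Cntr (⊢-cong (cong (nonlinear A ∷_) (move-lift ρ Γ₁)) (⊢-lift (lift ρ) (nonlinear A ∷ Γ₁)
         (relocate (lift-inverse (lift-inverse i))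
           (lift-reaches {Γ = nonlinear A ∷ Γ₁} (lift-reaches {Γ = Γ₁} (reaches-ˡ p r))) d)))
       (subst (_ ⊎_≔ _) (move-↦ ρ i e _) (move-⊎ ρ p))
relocate {ρ = ρ} i r (§-i d p) =
  §-i (relocate i (λ {y} l → r (l ∘ ⇝-absent (Pointwise.lookup p y))) d) (move-⇝ ρ p)
relocate {τ = τ} {ρ = ρ} i r (§-e {E₂ = Γ₂} {t = t} {u} d₁ d₂ p) rewrite sub-[] τ t u =
  §-e (relocate i (reaches-ˡ p r) d₁)
      (⊢-lift ρ Γ₂ (relocate (lift-inverse i) (lift-reaches {Γ = Γ₂} (reaches-ʳ p r)) d₂))
      (move-⊎ ρ p)
relocate {Γ = Γ} {ρ = ρ} i r (∀-i d) =
  ∀-i (⊢-cong (move-weaken ρ Γ)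
    (relocate i (λ {y} l → r λ e → l (trans (lookup-map y weakenSlot Γ) (cong weakenSlot e))) d))
relocate i r (∀-e d) = ∀-e (relocate i r d)

relocate-to : {τ : Fin m → Term n} (ρ : Fin n → Maybe (Fin m)) → Inverse τ ρ → Reaches ρ Γ →
              (∀ x → maybe′ (lookup Γ) absent (ρ x) ≡ lookup Γ′ x) →
              Γ ⊢ t ∶ A → Γ′ ⊢ sub τ t ∶ A
relocate-to {Γ = Γ} ρ i r e d = ⊢-cong (≗⇒≡ λ x → trans (lookup-move ρ Γ x) (e x)) (relocate i r d)

⊢-++ˡ : {F : Env k N} → F ⊢ t ∶ A → F ++ ∅ {n = M} ⊢ sub (var ∘ (_↑ˡ M)) t ∶ A
⊢-++ˡ {N = N} {M = M} {F = F} =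
  relocate-to ρ i (λ {y} l → y ↑ˡ M , cong [ just , const nothing ]′ (splitAt-↑ˡ N y M)) e
  where
  ρ : Fin (N + M) → Maybe (Fin N)
  ρ x = [ just , const nothing ]′ (splitAt N x)
  i : Inverse (var ∘ (_↑ˡ M)) ρ
  i {x} e with splitAt N x in eq
  i {x} refl | inj₁ y = cong var (splitAt⁻¹-↑ˡ eq)
  e : ∀ x → maybe′ (lookup F) absent (ρ x) ≡ lookup (F ++ ∅) x
  e x rewrite lookup-splitAt N F (∅ {n = M}) x with splitAt N x
  ... | inj₁ y = refl
  ... | inj₂ z = sym (lookup-replicate z absent)

⊢-++ʳ : {F : Env k M} → F ⊢ t ∶ A → ∅ {n = N} ++ F ⊢ sub (var ∘ (N ↑ʳ_)) t ∶ A
⊢-++ʳ {M = M} {N = N} {F = F} =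
  relocate-to ρ i (λ {y} l → N ↑ʳ y , cong [ const nothing , just ]′ (splitAt-↑ʳ N M y)) e
  where
  ρ : Fin (N + M) → Maybe (Fin M)
  ρ x = [ const nothing , just ]′ (splitAt N x)
  i : Inverse (var ∘ (N ↑ʳ_)) ρ
  i {x} e with splitAt N x in eq
  i {x} refl | inj₂ y = cong var (splitAt⁻¹-↑ʳ eq)
  e : ∀ x → maybe′ (lookup F) absent (ρ x) ≡ lookup (∅ {n = N} ++ F) x
  e x rewrite lookup-splitAt N (∅ {n = N}) F x with splitAt N x
  ... | inj₁ y = sym (lookup-replicate y absent)
  ... | inj₂ z = refl

drop : (v : Term n) → absent ∷ G ⊢ t ∶ A → G ⊢ sub (v ∷ᶠ var) t ∶ A
drop v = relocate-to (just ∘ suc) (λ { refl → refl })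
  (λ { {zero} l → contradiction refl l ; {suc y} l → y , refl }) (λ x → refl)

place : (x : Fin n) → lookup G x ≡ absent → s ∷ G ⊢ t ∶ A → G [ x ]≔ s ⊢ sub (var x ∷ᶠ var) t ∶ A
place {n = n} {G = G} {s = s} x a = relocate-to ρ i r e
  where
  ρ : Fin n → Maybe (Fin (suc n))
  ρ y with x ≟ y
  ... | yes _ = just zero
  ... | no  _ = just (suc y)
  i : Inverse (var x ∷ᶠ var) ρ
  i {y} e with x ≟ y
  i refl | yes refl = refl
  i refl | no _     = refl
  r : Reaches ρ (s ∷ G)
  r {zero} l = x , lemma
    where
    lemma : ρ x ≡ just zero
    lemma with x ≟ x
    ... | yes _ = refl
    ... | no ne = contradiction refl ne
  r {suc y} l = y , lemma
    where
    lemma : ρ y ≡ just (suc y)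
    lemma with x ≟ y
    ... | yes refl = contradiction a l
    ... | no _     = refl
  e : ∀ y → maybe′ (lookup (s ∷ G)) absent (ρ y) ≡ lookup (G [ x ]≔ s) y
  e y with x ≟ y
  ... | yes refl = sym (lookup∘update x G s)
  ... | no ne    = sym (lookup∘update′ (ne ∘ sym) G s)

-- (Cntr) contracts the two innermost variables only. So `x` is first relocated to the second
-- innermost position, its old slot being emptied (`G₀`), and the contraction puts it back at `x`.
merge : (x : Fin n) → lookup G x ≡ nonlinear B → nonlinear B ∷ G ⊢ t ∶ A → G ⊢ sub (var x ∷ᶠ var) t ∶ A
merge {n = n} {G = G} {B = B} {t = t} x a d =
  subst (G ⊢_∶ _) eq (Cntr {x = x} (relocate-to ρ i r e d) (⊎-∀ split))
  where
  G₀ = G [ x ]≔ absent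
  τ : Fin (suc n) → Term (suc (suc n))
  τ zero    = var zero
  τ (suc y) with x ≟ y
  ... | yes _ = var (suc zero)
  ... | no  _ = var (suc (suc y))
  ρ : Fin (suc (suc n)) → Maybe (Fin (suc n))
  ρ zero          = just zero
  ρ (suc zero)    = just (suc x)
  ρ (suc (suc y)) with x ≟ y
  ... | yes _ = nothing
  ... | no  _ = just (suc y)
  i : Inverse τ ρ
  i {zero} refl = refl
  i {suc zero} refl with x ≟ x
  ... | yes _ = refl
  ... | no ne = contradiction refl ne
  i {suc (suc y)} e with x ≟ y in eq
  i {suc (suc y)} refl | no ne rewrite eq = refl
  r : Reaches ρ (nonlinear B ∷ G)
  r {zero} l = zero , refl
  r {suc y} l with x ≟ y in eq
  ... | yes refl = suc zero , refl
  ... | no ne    = suc (suc y) , lemma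
    where
    lemma : ρ (suc (suc y)) ≡ just (suc y)
    lemma rewrite eq = refl
  e : ∀ y → maybe′ (lookup (nonlinear B ∷ G)) absent (ρ y) ≡ lookup (nonlinear B ∷ nonlinear B ∷ G₀) y
  e zero       = refl
  e (suc zero) = a
  e (suc (suc y)) with x ≟ y
  ... | yes refl = sym (lookup∘update x G absent)
  ... | no ne    = sym (lookup∘update′ (ne ∘ sym) G absent)
  split : ∀ y → lookup G₀ y ⊎ˢ lookup (x ↦ nonlinear B) y ≔ lookup G y
  split y with y ≟ x
  ... | yes refl = right-≡ (lookup∘update x G absent) (trans (lookup-↦ x _) (sym a))
  ... | no ne    = left-≡ (lookup∘update′ ne G absent) (lookup-↦-≢ ne _)
  eq : contract x (sub τ t) ≡ sub (var x ∷ᶠ var) t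
  eq = trans (contract≡sub x (sub τ t)) (trans (sub-sub _ τ t) (sub-cong lemma t))
    where
    lemma : sub (var x ∷ᶠ var x ∷ᶠ var) ∘ τ ≗ var x ∷ᶠ var
    lemma zero = refl
    lemma (suc y) with x ≟ y
    ... | yes refl = refl
    ... | no _     = refl

-- Identifying several variables at once

join : (Fin N → Term M) → Fin (N + M) → Term M
join {zero}  τ = var
join {suc N} τ = τ zero ∷ᶠ join (τ ∘ suc)

join-↑ˡ : (τ : Fin N → Term M) (y : Fin N) → join τ (y ↑ˡ M) ≡ τ y
join-↑ˡ τ zero    = refl
join-↑ˡ τ (suc y) = join-↑ˡ (τ ∘ suc) y

join-↑ʳ : (τ : Fin N → Term M) (x : Fin M) → join τ (N ↑ʳ x) ≡ var x
join-↑ʳ {zero}  τ x = refl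
join-↑ʳ {suc N} τ x = join-↑ʳ (τ ∘ suc) x

sub-join : (τ : Fin (suc N) → Term M) (t : Term (suc (N + M))) {v : Term (N + M)} →
           v ≡ ren (N ↑ʳ_) (τ zero) → sub (join (τ ∘ suc)) (sub (v ∷ᶠ var) t) ≡ sub (join τ) t
sub-join {N = N} τ t refl = trans (sub-sub (join (τ ∘ suc)) _ t) (sub-cong (λ where
  zero    → trans (sub-ren (join (τ ∘ suc)) (N ↑ʳ_) (τ zero))
              (trans (sub-cong (join-↑ʳ (τ ∘ suc)) (τ zero)) (sub-var (τ zero)))
  (suc y) → refl) t)

Fits : Env k N → (Fin N → Term M) → Env k M → Set
Fits F τ E = ∀ {y} → lookup F y ≢ absent → ∃[ x ] τ y ≡ var x × lookup E x ≡ lookup F y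

LinearInjective : Env k N → (Fin N → Term M) → Set
LinearInjective F τ = ∀ {y y′ x L L′} → lookup F y ≡ linear L → lookup F y′ ≡ linear L′ →
                      τ y ≡ var x → τ y′ ≡ var x → y ≡ y′

-- Keeps the slots awaited by the linear variables of `F` empty in the part `H` of `E` built so far,
-- so that `place` applies to them.
Fresh : Env k N → (Fin N → Term M) → Env k M → Set
Fresh F τ H = ∀ {y x L} → lookup F y ≡ linear L → τ y ≡ var x → lookup H x ≡ absent

update-⊑ : {H E : Env k n} (x : Fin n) → lookup E x ≡ s → lookup H ⊑ lookup E →
           lookup (H [ x ]≔ s) ⊑ lookup E
update-⊑ {s = s} {H = H} x e h {y} l with y ≟ x
... | yes refl = trans e (sym (lookup∘update x H s))
... | no ne    = trans (h (≢absent (sym (lookup∘update′ ne H s)) l)) (sym (lookup∘update′ ne H s))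

-- The variables of F are moved into H one at a time, the nonlinear ones that meet
-- a variable of H being contracted with it.

collapse-++ : {E : Env k M} (F : Env k N) (H : Env k M) (τ : Fin N → Term M) {t : Term (N + M)} →
              F ++ H ⊢ t ∶ A → lookup H ⊑ lookup E → Fits F τ E → LinearInjective F τ → Fresh F τ H →
              E ⊢ sub (join τ) t ∶ A
collapse-++ [] H τ {t} d h fits inj fresh = subst (_ ⊢_∶ _) (sym (sub-var t)) (⊢-⊑ d h)
collapse-++ {N = suc N} (absent ∷ F) H τ {t} d h fits inj fresh =
  subst (_ ⊢_∶ _) (sub-join τ t refl)
    (collapse-++ F H (τ ∘ suc) (drop _ d) h (fits {suc _})
      (λ e e′ p p′ → suc-injective (inj e e′ p p′)) (fresh {suc _}))
collapse-++ {N = suc N} {E = E} (linear L ∷ F) H τ {t} d h fits inj fresh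
  with x , e , e′ ← fits {zero} (λ ()) =
  subst (_ ⊢_∶ _) (sub-join τ t (cong (ren (N ↑ʳ_)) (sym e)))
    (collapse-++ F (H [ x ]≔ linear L) (τ ∘ suc)
      (⊢-cong ([]≔-++-↑ʳ F H x)
        (place (N ↑ʳ x) (trans (lookup-++ʳ F H x) (fresh {zero} refl e)) d))
      (update-⊑ {H = H} {E} x e′ h) (fits {suc _}) (λ e e′ p p′ → suc-injective (inj e e′ p p′)) fresh′)
  where
  fresh′ : Fresh F (τ ∘ suc) (H [ x ]≔ linear L)
  fresh′ {y} {x′} q p with x′ ≟ x
  ... | yes refl = case inj {zero} {suc y} refl q e p of λ ()
  ... | no ne    = trans (lookup∘update′ ne H (linear L)) (fresh {suc y} q p)
collapse-++ {N = suc N} {E = E} (nonlinear B ∷ F) H τ {t} d h fits inj fresh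
  with x , e , e′ ← fits {zero} (λ ()) = by-slot (lookup H x) refl
  where
  eq : sub (join (τ ∘ suc)) (sub (var (N ↑ʳ x) ∷ᶠ var) t) ≡ sub (join τ) t
  eq = sub-join τ t (cong (ren (N ↑ʳ_)) (sym e))
  inj′ : LinearInjective F (τ ∘ suc)
  inj′ e e′ p p′ = suc-injective (inj e e′ p p′)
  fresh′ : Fresh F (τ ∘ suc) (H [ x ]≔ nonlinear B)
  fresh′ {y} {x′} q p with x′ ≟ x
  ... | no ne    = trans (lookup∘update′ ne H (nonlinear B)) (fresh {suc y} q p)
  -- A linear variable sent to `x` as well would disagree with the nonlinear one about the slot of
  -- `x` in `E`.
  ... | yes refl with _ , p′ , q′ ← fits {suc y} (≢absent q λ ()) with refl ← trans (sym p) p′ =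
    case trans (sym e′) (trans q′ q) of λ ()
  by-slot : ∀ s → lookup H x ≡ s → E ⊢ sub (join τ) t ∶ _
  by-slot absent a = subst (_ ⊢_∶ _) eq (collapse-++ F (H [ x ]≔ nonlinear B) (τ ∘ suc)
    (⊢-cong ([]≔-++-↑ʳ F H x) (place (N ↑ʳ x) (trans (lookup-++ʳ F H x) a) d))
    (update-⊑ {H = H} {E} x e′ h) (fits {suc _}) inj′ fresh′)
  by-slot (nonlinear B′) a with refl ← trans (sym e′) (trans (h (≢absent a λ ())) a) =
    subst (_ ⊢_∶ _) eq (collapse-++ F H (τ ∘ suc)
      (merge (N ↑ʳ x) (trans (lookup-++ʳ F H x) a) d) h (fits {suc _}) inj′ (fresh {suc _}))
  by-slot (linear L) a = case trans (sym e′) (trans (h (≢absent a λ ())) a) of λ ()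

-- Contraction, weakening and exchange in one step. `H` starts as `∅`, and what it still misses of
-- `E` in the end is supplied by (Weak).
collapse : {E : Env k M} {F : Env k N} {τ : Fin N → Term M} →
           F ⊢ t ∶ A → Fits F τ E → LinearInjective F τ → E ⊢ sub τ t ∶ A
collapse {t = t} {E = E} {F} {τ} d fits inj = subst (_ ⊢_∶ _)
  (trans (sub-sub (join τ) _ t) (sub-cong (join-↑ˡ τ) t))
  (collapse-++ F ∅ τ (⊢-++ˡ d) (λ {x} l → contradiction (lookup-replicate x absent) l)
    fits inj (λ {_} {x} _ _ → lookup-replicate x absent))

-- Lower bounds on occurrences

used-sub : (τ : Fin m → Term n) (t : Term m) (y : Fin m) (w : Fin n → ℕ) →
           1 ≤ ‖ t ‖ (δ y) → 1 ≤ ‖ τ y ‖ w → 1 ≤ ‖ sub τ t ‖ w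
used-sub τ t y w p q = ≤-trans p (≤-trans (‖‖-mono t le) (≤-reflexive (sym (‖‖-sub τ t w))))
  where
  le : ∀ x → δ y x ≤ ‖ τ x ‖ w
  le x with y ≟ x
  ... | yes refl = ≤-trans (δ-≤1 y y) q
  ... | no ne    = ≤-trans (≤-reflexive (δ-≢ ne)) z≤n

-- The source of disjointness in the translation back to DLAL: a count of at least 2 contradicts the
-- bound 1, so two distinct used variables cannot both have an image of positive weight.
used-twice : (τ : Fin m → Term n) (t : Term m) (w : Fin n → ℕ) {y y′ : Fin m} → y ≢ y′ →
             1 ≤ ‖ t ‖ (δ y) → 1 ≤ ‖ t ‖ (δ y′) → 1 ≤ ‖ τ y ‖ w → 1 ≤ ‖ τ y′ ‖ w → 2 ≤ ‖ sub τ t ‖ w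
used-twice τ t w {y} {y′} ne p p′ q q′ = begin
  2                               ≤⟨ +-mono-≤ p p′ ⟩
  ‖ t ‖ (δ y) + ‖ t ‖ (δ y′)      ≡⟨ ‖‖-+ t (δ y) (δ y′) ⟨
  ‖ t ‖ (λ x → δ y x + δ y′ x)    ≤⟨ ‖‖-mono t le ⟩
  ‖ t ‖ (λ x → ‖ τ x ‖ w)         ≡⟨ ‖‖-sub τ t w ⟨
  ‖ sub τ t ‖ w                   ∎
  where
  open ≤-Reasoning
  le : ∀ x → δ y x + δ y′ x ≤ ‖ τ x ‖ w
  le x with y ≟ x
  ... | yes refl = ≤-trans (≤-reflexive (cong (δ y y +_) (δ-≢ (ne ∘ sym))))
                     (≤-trans (≤-reflexive (trans (+-identityʳ _) (δ-refl y))) q)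
  ... | no y≢x rewrite δ-≢ y≢x with y′ ≟ x
  ...   | yes refl = ≤-trans (δ-≤1 y′ y′) q′
  ...   | no y′≢x  = ≤-trans (≤-reflexive (δ-≢ y′≢x)) z≤n

-- From the level calculus to DLAL

-- The image of absent variables, chosen closed so that it is stable under renaming.

dummy : Term n
dummy = ƛ (var zero)

data Slice {n : ℕ} : Stack n k → Frame k n → Term n → Type k → Set

-- A hole keeps its type in the form `B / θ`, which shows that it comes from the type scope of the
-- level below; `ungeneralise` relies on this.
data Atom {n : ℕ} : Stack n k → Frame k n → Slot k → Term n → Set where
  none          : Atom S E absent dummy
  linear-var    : E x ≡ linear L → Atom S E (linear L) (var x)
  nonlinear-var : E x ≡ nonlinear A → Atom S E (nonlinear A) (var x)
  hole          : Slice S D u (§ B) → Atom (S ▸ D ⟨ θ ⟩) E (linear (type (B / θ))) u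

-- Only if the linear variables of `F` do occur in `t` can a bound on the occurrences in `sub σ t`
-- force their images apart.
Used : Env k N → Term N → Set
Used F t = ∀ {y L} → lookup F y ≡ linear L → 1 ≤ ‖ t ‖ (δ y)

data Slice {n} where
  slice : (F : Env k N) (σ : Fin N → Term n) {t : Term N} → F ⊢ t ∶ A → Used F t →
          (∀ y → Atom S E (lookup F y) (σ y)) → Slice S E (sub σ t) A

slice-cong : t ≡ u → Slice S E t A → Slice S E u A
slice-cong refl T = T

⊢var : (L : Formula k) → linear L ∷ [] ⊢ var zero ∶ ⌊ L ⌋
⊢var (type A) = Id
⊢var [ A ]§   = §-i Id (discharge ∷ [])

slice-hole : Slice S D u (§ B) → Slice (S ▸ D ⟨ θ ⟩) E u (B / θ)
slice-hole {u = u} {B = B} {θ = θ} h =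
  slice (linear (type (B / θ)) ∷ []) (const u) (⊢var (type (B / θ)))
    (λ { {zero} _ → s≤s z≤n }) λ { zero → hole h }

slice-var : S ∣ E ∋ x ∶ A → Slice S E (var x) A
slice-var (here {L = L} e) = slice (linear L ∷ []) (const (var _)) (⊢var L)
  (λ { {zero} _ → s≤s z≤n }) λ { zero → linear-var e }
-- The variable is boxed one level below by (§ i), and the box is then popped.
slice-var (below {A = A} e) = slice-hole
  (slice (nonlinear A ∷ []) (const (var _)) (§-i (⊢var (type A)) (nonlinear ∷ []))
    (λ { {zero} () }) λ { zero → nonlinear-var e })

-- Slices side by side: applications

_⧺_ : {X : Set} → (Fin N → X) → (Fin M → X) → Fin (N + M) → X
_⧺_ {N} f g x = [ f , g ]′ (splitAt N x)

⧺-↑ˡ : {X : Set} (f : Fin N → X) (g : Fin M → X) (y : Fin N) → (f ⧺ g) (y ↑ˡ M) ≡ f y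
⧺-↑ˡ {N} {M} f g y = cong [ f , g ]′ (splitAt-↑ˡ N y M)

⧺-↑ʳ : {X : Set} (f : Fin N → X) (g : Fin M → X) (y : Fin M) → (f ⧺ g) (N ↑ʳ y) ≡ g y
⧺-↑ʳ {N} {M} f g y = cong [ f , g ]′ (splitAt-↑ʳ N M y)

++-case : (P : Fin (N + M) → Set) → (∀ y → P (y ↑ˡ M)) → (∀ y → P (N ↑ʳ y)) → ∀ y → P y
++-case {N} P f g y with splitAt N y in eq
... | inj₁ y′ = subst P (splitAt⁻¹-↑ˡ eq) (f y′)
... | inj₂ y′ = subst P (splitAt⁻¹-↑ʳ eq) (g y′)

⊎-++ : (F : Env k N) {G : Env k M} → F ++ ∅ ⊎ ∅ ++ G ≔ F ++ G
⊎-++ []      {[]}    = []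
⊎-++ []      {_ ∷ _} = right ∷ ⊎-++ []
⊎-++ (s ∷ F)         = left ∷ ⊎-++ F

⊎-++′ : (F : Env k N) {G : Env k M} → ∅ ++ G ⊎ F ++ ∅ ≔ F ++ G
⊎-++′ []      {[]}    = []
⊎-++′ []      {_ ∷ _} = left ∷ ⊎-++′ []
⊎-++′ (s ∷ F)         = right ∷ ⊎-++′ F

++-↦ : (z : Fin M) → ∅ {n = N} ++ (z ↦ s) ≡ (N ↑ʳ z) ↦ s
++-↦ {N = zero}  z = refl
++-↦ {N = suc N} z = cong (absent ∷_) (++-↦ {N = N} z)

used-++ : (F : Env k N) (G : Env k M) (s : Term (N + M)) →
          (∀ {y L} → lookup F y ≡ linear L → 1 ≤ ‖ s ‖ (δ (y ↑ˡ M))) →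
          (∀ {y L} → lookup G y ≡ linear L → 1 ≤ ‖ s ‖ (δ (N ↑ʳ y))) → Used (F ++ G) s
used-++ F G s f g {y} = ++-case (λ y → ∀ {L} → lookup (F ++ G) y ≡ linear L → 1 ≤ ‖ s ‖ (δ y))
  (λ y e → f (trans (sym (lookup-++ˡ F G y)) e)) (λ y e → g (trans (sym (lookup-++ʳ F G y)) e)) y

atoms-++ : (F : Env k N) (G : Env k M) {σ : Fin N → Term n} {τ : Fin M → Term n} →
           (∀ y → Atom S E (lookup F y) (σ y)) → (∀ y → Atom S E (lookup G y) (τ y)) →
           ∀ y → Atom S E (lookup (F ++ G) y) ((σ ⧺ τ) y)
atoms-++ F G {σ} {τ} a b = ++-case _
  (λ y → subst₂ (Atom _ _) (sym (lookup-++ˡ F G y)) (sym (⧺-↑ˡ σ τ y)) (a y))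
  (λ y → subst₂ (Atom _ _) (sym (lookup-++ʳ F G y)) (sym (⧺-↑ʳ σ τ y)) (b y))

slice-· : (F : Env k N) (G : Env k M) (σ : Fin N → Term n) (τ : Fin M → Term n) (t : Term N) (u : Term M) →
          F ++ G ⊢ sub (var ∘ (_↑ˡ M)) t · sub (var ∘ (N ↑ʳ_)) u ∶ A → Used F t → Used G u →
          (∀ y → Atom S E (lookup F y) (σ y)) → (∀ y → Atom S E (lookup G y) (τ y)) →
          Slice S E (sub σ t · sub τ u) A
slice-· {N = N} {M = M} F G σ τ t u d p q a b =
  slice-cong
    (cong₂ _·_ (trans (sub-sub (σ ⧺ τ) _ t) (sub-cong (⧺-↑ˡ σ τ) t))
               (trans (sub-sub (σ ⧺ τ) _ u) (sub-cong (⧺-↑ʳ σ τ) u)))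
    (slice (F ++ G) (σ ⧺ τ) d
      (used-++ F G (sub (var ∘ (_↑ˡ M)) t · sub (var ∘ (N ↑ʳ_)) u)
        (λ {y} e → ≤-trans
          (used-sub (var ∘ (_↑ˡ M)) t y (δ (y ↑ˡ M)) (p e) (≤-reflexive (sym (δ-refl (y ↑ˡ M))))) (m≤m+n _ _))
        (λ {y} e → ≤-trans
          (used-sub (var ∘ (N ↑ʳ_)) u y (δ (N ↑ʳ y)) (q e) (≤-reflexive (sym (δ-refl (N ↑ʳ y))))) (m≤n+m _ _)))
      (atoms-++ F G a b))

slice-⊸-e : Slice S E t (A ⊸ B) → Slice S E u A → Slice S E (t · u) B
slice-⊸-e (slice F σ {t} d p a) (slice G τ {u} e q b) =
  slice-· F G σ τ t u (⊸-e (⊢-++ˡ d) (⊢-++ʳ e) (⊎-++ F)) p q a b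

find : (F : Env k N) → F ≡ ∅ ⊎′ (∃[ y ] lookup F y ≢ absent)
find []                = inj₁ refl
find (nonlinear A ∷ F) = inj₂ (zero , λ ())
find (linear L ∷ F)    = inj₂ (zero , λ ())
find (absent ∷ F) with find F
... | inj₁ refl    = inj₁ refl
... | inj₂ (y , l) = inj₂ (suc y , l)

atom-bang : {s : Slot k} → Atom ε (bang ∘ E) s u →
            (s ≡ absent × u ≡ dummy) ⊎′
            (∃[ x ] ∃[ C ] s ≡ linear (type C) × u ≡ var x × E x ≡ nonlinear C)
atom-bang none = inj₁ (refl , refl)
atom-bang {E = E} (linear-var {x = x} e) with bang-linear (E x) e
... | C , e′ , refl = inj₂ (x , C , refl , refl , e′)
atom-bang {E = E} (nonlinear-var {x = x} e) = contradiction e (bang-nonlinear (E x))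

-- A slice at level 0 has no holes, so the declared variables of `G` stand for variables and, by
-- `bang`, are linear. As all of them occur in the argument, the bound 1 leaves at most one, the `z`
-- of (⇒ e); if there is none, `⇒-e∅` applies.
slice-⇒-e : Slice S E t (A ⇒ B) → Slice ε (bang ∘ E) u A → ‖ u ‖ (const 1) ≤ 1 → Slice S E (t · u) B
slice-⇒-e {E = E} (slice F σ {t} d p a) (slice {N = M} G τ {u} e q b) c with find G
... | inj₁ refl = slice-· F ∅ σ τ t u (⇒-e∅ (⊢-++ˡ d) (⊢-cong ∅++∅ (⊢-++ʳ e))) p q a closed
  where
  ∅++∅ : ∀ {N} → ∅ {n = N} ++ ∅ {n = M} ≡ ∅
  ∅++∅ {zero}  = refl
  ∅++∅ {suc N} = cong (absent ∷_) (∅++∅ {N})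
  closed : ∀ y → Atom _ E (lookup ∅ y) (τ y)
  closed y with atom-bang (b y)
  ... | inj₁ (s , e) = subst₂ (Atom _ _) (sym s) (sym e) none
  ... | inj₂ (_ , _ , s , _) = case trans (sym (lookup-replicate y absent)) s of λ ()
... | inj₂ (z , l) with atom-bang (b z)
...   | inj₁ (s , _) = contradiction s l
...   | inj₂ (x , C , s , e₁ , e₂) =
  slice-· F (z ↦ nonlinear C) σ τ t u
    (⇒-e (⊢-++ˡ d) (⊢-cong (trans (cong (∅ ++_) G≡) (++-↦ z)) (⊢-++ʳ e))
      (subst (F ++ ∅ ⊎_≔ F ++ (z ↦ nonlinear C)) (++-↦ z) (⊎-++ F)))
    p (λ {y} e → case ↦-nonlinear y e of λ ()) a atoms
  where
  unique : ∀ {y} → y ≢ z → lookup G y ≡ absent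
  unique {y} ne with atom-bang (b y)
  ... | inj₁ (s′ , _) = s′
  ... | inj₂ (_ , _ , s′ , e′ , _) = contradiction
    (used-twice τ u (const 1) ne (q s′) (q s) (weight e′) (weight e₁))
    (<⇒≱ (s≤s c))
    where
    weight : ∀ {y x} → τ y ≡ var x → 1 ≤ ‖ τ y ‖ (const 1)
    weight e rewrite e = s≤s z≤n
  G≡ : G ≡ z ↦ linear (type C)
  G≡ = ≗⇒≡ λ y → case y ≟ z of λ where
    (yes refl) → trans s (sym (lookup-↦ z _))
    (no ne)    → trans (unique ne) (sym (lookup-↦-≢ ne _))
  ↦-nonlinear : ∀ y {L} → lookup (z ↦ nonlinear C) y ≢ linear L
  ↦-nonlinear y e with refl ← ↦-live y z (≢absent e λ ()) = case trans (sym (lookup-↦ z _)) e of λ ()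
  atoms : ∀ y → Atom _ E (lookup (z ↦ nonlinear C) y) (τ y)
  atoms y with y ≟ z
  ... | yes refl = subst₂ (Atom _ _) (sym (lookup-↦ z _)) (sym e₁) (nonlinear-var e₂)
  ... | no ne with atom-bang (b y)
  ...   | inj₁ (_ , e)          = subst₂ (Atom _ _) (sym (lookup-↦-≢ ne _)) (sym e) none
  ...   | inj₂ (_ , _ , s′ , _) = case trans (sym (unique ne)) s′ of λ ()

-- The bound variable is absent from every frame below, so no hole contains it: an image is that
-- variable itself or avoids it. The stack enters by an equation because an index `bind S` would
-- obstruct matching on `hole`.
unbind-atom : (S : Stack n k) {S′ : Stack (suc n) k} {f : Slot k} {u : Term (suc n)} →
              S′ ≡ bind S → Atom S′ (s ∷ᶠ E) f u →
              (u ≡ var zero × f ≡ s × s ≢ absent) ⊎′ (∃[ u′ ] u ≡ ren suc u′ × Atom S E f u′)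
unbind-slice : {u : Term (suc n)} → Slice (bind S) (absent ∷ᶠ E) u A →
               ∃[ u′ ] u ≡ ren suc u′ × Slice S E u′ A

unbind-atom S _ none                          = inj₂ (dummy , refl , none)
unbind-atom S _ (linear-var {x = zero} e)     = inj₁ (refl , sym e , ≢absent e λ ())
unbind-atom S _ (linear-var {x = suc x} e)    = inj₂ (var x , refl , linear-var e)
unbind-atom S _ (nonlinear-var {x = zero} e)  = inj₁ (refl , sym e , ≢absent e λ ())
unbind-atom S _ (nonlinear-var {x = suc x} e) = inj₂ (var x , refl , nonlinear-var e)
unbind-atom (S ▸ D ⟨ θ ⟩) refl (hole h) with u′ , e , h′ ← unbind-slice h = inj₂ (u′ , e , hole h′)

unbind-slice {n = n} {S = S} {E = E} (slice {N = N} F σ {t} d q a) =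
  sub σ′ t , trans (sub-cong (λ y → free y .proj₂ .proj₁) t) (sym (ren-sub suc σ′ t)) ,
  slice F σ′ d q (λ y → free y .proj₂ .proj₂)
  where
  free : ∀ y → ∃[ u′ ] σ y ≡ ren suc u′ × Atom S E (lookup F y) u′
  free y with unbind-atom S refl (a y)
  ... | inj₁ (_ , _ , l) = contradiction refl l
  ... | inj₂ r           = r
  σ′ : Fin N → Term n
  σ′ y = free y .proj₁

-- In the translation of an abstraction the variables standing for the bound one
-- are collapsed to a single variable.

module Collapsed {n k N} (S : Stack n k) (E : Frame k n) (s : Slot k)
                 (F : Env k N) (σ : Fin N → Term (suc n)) (t : Term N) (used : Used F t)
                 (a : ∀ y → Atom (bind S) (s ∷ᶠ E) (lookup F y) (σ y))
                 (once : ∀ {L} → s ≡ linear L → ‖ sub σ t ‖ (δ zero) ≤ 1) where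

  Case : Fin N → Set
  Case y = (σ y ≡ var zero × lookup F y ≡ s × s ≢ absent) ⊎′
           (∃[ u ] σ y ≡ ren suc u × Atom S E (lookup F y) u)

  cases : ∀ y → Case y
  cases y = unbind-atom S refl (a y)

  slot : ∀ {y} → Case y → Slot k
  slot     (inj₁ _) = absent
  slot {y} (inj₂ _) = lookup F y

  image : ∀ {y} → Case y → Term n
  image (inj₁ _)       = dummy
  image (inj₂ (u , _)) = u

  target : ∀ {y} → Case y → Term (suc N)
  target     (inj₁ _) = var zero
  target {y} (inj₂ _) = var (suc y)

  F′ : Env k N
  F′ = tabulate (slot ∘ cases)

  lookup-F′ : ∀ y → lookup F′ y ≡ slot (cases y)
  lookup-F′ = lookup∘tabulate (slot ∘ cases)

  fits : Fits F (target ∘ cases) (s ∷ F′)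
  fits {y} l with cases y in eq
  ... | inj₁ (_ , e , _) = zero , refl , sym e
  ... | inj₂ _           = suc y , refl , trans (lookup-F′ y) (cong slot eq)

  injective : LinearInjective F (target ∘ cases)
  injective {y} {y′} e e′ p p′ with y ≟ y′
  ... | yes y≡y′ = y≡y′
  ... | no  y≢y′ with cases y | cases y′
  -- Two linear variables standing for the bound one would give it two occurrences.
  ...   | inj₁ (b , f , _) | inj₁ (b′ , _) = contradiction
    (used-twice σ t (δ zero) y≢y′ (used e) (used e′) (weight b) (weight b′))
    (<⇒≱ (s≤s (once (trans (sym f) e))))
    where
    weight : ∀ {y} → σ y ≡ var zero → 1 ≤ ‖ σ y ‖ (δ zero)
    weight b rewrite b = s≤s z≤n
  ...   | inj₁ _ | inj₂ _ = case trans p (sym p′) of λ ()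
  ...   | inj₂ _ | inj₁ _ = case trans p (sym p′) of λ ()
  ...   | inj₂ _ | inj₂ _ = case trans p (sym p′) of λ { refl → refl }

  body : Term (suc N)
  body = sub (target ∘ cases) t

  body-⊢ : F ⊢ t ∶ B → s ∷ F′ ⊢ body ∶ B
  body-⊢ d = collapse d fits injective

  result : F′ ⊢ ƛ body ∶ A → Slice S E (ƛ (sub σ t)) A
  result d = slice-cong (cong ƛ (trans (sub-sub _ (target ∘ cases) t) (sub-cong eq t)))
    (slice F′ (image ∘ cases) d used′ λ y →
      subst (λ f → Atom S E f (image (cases y))) (sym (lookup-F′ y)) (atom (cases y)))
    where
    eq : ∀ y → sub (exts (image ∘ cases)) (target (cases y)) ≡ σ y
    eq y with cases y in q
    ... | inj₁ (e , _)     = sym e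
    ... | inj₂ (u , e , _) = trans (cong (ren suc ∘ image) q) (sym e)
    atom : ∀ {y} (c : Case y) → Atom S E (slot c) (image c)
    atom (inj₁ _)           = none
    atom (inj₂ (_ , _ , b)) = b
    used′ : Used F′ (ƛ body)
    used′ {y} e = used-sub (target ∘ cases) t y (0 ∷ᶠ δ y) (used (F-linear (cases y) e′)) (weight (cases y) e′)
      where
      e′ : slot (cases y) ≡ linear _
      e′ = trans (sym (lookup-F′ y)) e
      F-linear : ∀ {L} (c : Case y) → slot c ≡ linear L → lookup F y ≡ linear L
      F-linear (inj₂ _) e = e
      weight : ∀ {L} (c : Case y) → slot c ≡ linear L → 1 ≤ ‖ target c ‖ (0 ∷ᶠ δ y)
      weight (inj₂ _) _ = ≤-reflexive (sym (δ-refl y))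

slice-⊸-i : Slice (bind S) (linear (type A) ∷ᶠ E) t B → ‖ t ‖ (δ zero) ≤ 1 → Slice S E (ƛ t) (A ⊸ B)
slice-⊸-i {S = S} {E = E} (slice F σ {t} d q a) once = result (⊸-i (body-⊢ d))
  where open Collapsed S E _ F σ t q a (λ _ → once)

slice-⇒-i : Slice (bind S) (nonlinear A ∷ᶠ E) t B → Slice S E (ƛ t) (A ⇒ B)
slice-⇒-i {S = S} {E = E} (slice F σ {t} d q a) = result (⇒-i (body-⊢ d))
  where open Collapsed S E _ F σ t q a (λ ())

-- This makes (∀ i) applicable: slots of the current frame are weakenings, and the type of a hole is
-- `B` instantiated by a weakened θ, so the quantified variable occurs in neither.
ungeneralise : (S : Stack n k) {S′ : Stack n (suc k)} {E′ : Frame (suc k) n} {f : Slot (suc k)} →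
               S′ ≡ generalise S → E′ ≡ weakenSlot ∘ E → Atom S′ E′ f u →
               ∃[ f′ ] f ≡ weakenSlot f′ × Atom S E f′ u
ungeneralise S _ _ none = absent , refl , none
ungeneralise {E = E} S _ refl (linear-var {x = x} e) with L , e′ , refl ← weaken-linear (E x) e =
  linear L , refl , linear-var e′
ungeneralise {E = E} S _ refl (nonlinear-var {x = x} e) with A , e′ , refl ← weaken-nonlinear (E x) e =
  nonlinear A , refl , nonlinear-var e′
ungeneralise (S ▸ D ⟨ θ ⟩) refl _ (hole {B = B} h) =
  linear (type (B / θ)) , cong (linear ∘ type) (/-map-weaken B θ) , hole h

slice-∀-i : Slice (generalise S) (weakenSlot ∘ E) t A → Slice S E t (∀′ A)
slice-∀-i {S = S} {E = E} {A = A} (slice {N = N} F σ {t} d q a) =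
  slice F′ σ (∀-i (⊢-cong F≡ d))
    (λ {y} e → q (trans (slots y .proj₂ .proj₁) (cong weakenSlot (trans (sym (lookup∘tabulate _ y)) e))))
    (λ y → subst (λ f → Atom S E f (σ y)) (sym (lookup∘tabulate _ y)) (slots y .proj₂ .proj₂))
  where
  slots : ∀ y → ∃[ f ] lookup F y ≡ weakenSlot f × Atom S E f (σ y)
  slots y = ungeneralise S refl refl (a y)
  F′ : Env _ N
  F′ = tabulate (proj₁ ∘ slots)
  F≡ : F ≡ weakenEnv F′
  F≡ = ≗⇒≡ λ y → trans (slots y .proj₂ .proj₁)
    (sym (trans (lookup-map y weakenSlot F′) (cong weakenSlot (lookup∘tabulate (proj₁ ∘ slots) y))))

slice-∀-e : Slice S E t (∀′ A) → Slice S E t (A [ B ]ᵀ)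
slice-∀-e (slice F σ d q a) = slice F σ (∀-e d) q a

-- Closing a box

data Let {n k} (S : Stack n k) (E : Frame k n) : Slot k → Term n → Set where
  none : Let S E absent dummy
  hole : Slice S E u (§ B) → Let S E (linear [ B ]§) u

-- The first P variables are those still to be eliminated by (§ e); each
-- elimination appends the variables of the slice that is substituted.

slice-let : ∀ P {K} (F : Env k K) (σ : Fin K → Term n) {t : Term K} → F ⊢ t ∶ C → Used F t → P ≤ K →
            (∀ y → toℕ y < P → Let S E (lookup F y) (σ y)) →
            (∀ y → P ≤ toℕ y → Atom S E (lookup F y) (σ y)) →
            Slice S E (sub σ t) C
-- `u` is kept apart from `σ zero` so that matching on the `Let` can refine it.
slice-let-∷ : ∀ P {K f} (F : Env k K) (σ : Fin (suc K) → Term n) {t : Term (suc K)} →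
              f ∷ F ⊢ t ∶ C → Used (f ∷ F) t → P ≤ K → Let S E f u → σ zero ≡ u →
              (∀ y → toℕ y < P → Let S E (lookup F y) (σ (suc y))) →
              (∀ y → P ≤ toℕ y → Atom S E (lookup F y) (σ (suc y))) →
              Slice S E (sub σ t) C

slice-let zero F σ d q _ b a = slice F σ d q (λ y → a y z≤n)
slice-let (suc P) (f ∷ F) σ d q (s≤s P≤K) b a =
  slice-let-∷ P F σ d (λ {y} → q {y}) P≤K (b zero (s≤s z≤n)) refl
    (λ y l → b (suc y) (s≤s l)) (λ y l → a (suc y) (s≤s l))

slice-let-∷ P F σ {t} d q P≤K none eq b a =
  slice-cong (trans (sub-sub (σ ∘ suc) (dummy ∷ᶠ var) t) (sub-cong (λ { zero → sym eq ; (suc y) → refl }) t))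
    (slice-let P F (σ ∘ suc) (drop dummy d)
      (λ {y} e → used-sub (dummy ∷ᶠ var) t (suc y) (δ y) (q {suc y} e) (≤-reflexive (sym (δ-refl y))))
      P≤K b a)
slice-let-∷ {S = S} {E = E} P {K} F σ {t} d q P≤K (hole (slice {N = M} G τ {u} e r c)) eq b a =
  slice-cong (trans (cong (sub ((σ ∘ suc) ⧺ τ)) body≡) (trans (sub-sub _ κ t) (sub-cong image t)))
    -- The pending variables stay in front; those of `G` go behind, at positions from `K` on, and
    -- since `P ≤ K` they are treated as atoms.
    (slice-let P (F ++ G) ((σ ∘ suc) ⧺ τ) (§-e (⊢-++ʳ e) (⊢-++ˡ d) (⊎-++′ F)) used
      (≤-trans P≤K (m≤m+n K M)) lets atoms)
  where
  u′ : Term (K + M)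
  u′ = sub (var ∘ (K ↑ʳ_)) u
  κ : Fin (suc K) → Term (K + M)
  κ = u′ ∷ᶠ var ∘ (_↑ˡ M)
  body : Term (K + M)
  body = sub (var ∘ (_↑ˡ M)) t [ u′ ]
  body≡ : body ≡ sub κ t
  body≡ = trans ([]≡sub (sub (var ∘ (_↑ˡ M)) t) u′)
    (trans (sub-sub (u′ ∷ᶠ var) (var ∘ (_↑ˡ M)) t) (sub-cong (λ { zero → refl ; (suc y) → refl }) t))
  image : ∀ y → sub ((σ ∘ suc) ⧺ τ) (κ y) ≡ σ y
  image zero    = trans (sub-sub _ _ u) (trans (sub-cong (⧺-↑ʳ (σ ∘ suc) τ) u) (sym eq))
  image (suc y) = ⧺-↑ˡ (σ ∘ suc) τ y
  used : Used (F ++ G) body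
  used rewrite body≡ = used-++ F G (sub κ t)
    (λ {y} p → used-sub κ t (suc y) _ (q {suc y} p) (≤-reflexive (sym (δ-refl (y ↑ˡ M)))))
    -- A linear variable of `G` occurs in `u`, which replaces a variable that occurs in `t` because
    -- its slot is linear.
    (λ {y} p → used-sub κ t zero _ (q {zero} refl)
      (used-sub (var ∘ (K ↑ʳ_)) u y _ (r p) (≤-reflexive (sym (δ-refl (K ↑ʳ y))))))
  lets : ∀ y → toℕ y < P → Let S E (lookup (F ++ G) y) (((σ ∘ suc) ⧺ τ) y)
  lets = ++-case _
    (λ y l → subst₂ (Let S E) (sym (lookup-++ˡ F G y)) (sym (⧺-↑ˡ (σ ∘ suc) τ y))
      (b y (subst (_< P) (toℕ-↑ˡ y M) l)))
    (λ y l → contradiction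
      (≤-trans P≤K (≤-trans (m≤m+n K (toℕ y)) (≤-reflexive (sym (toℕ-↑ʳ K y))))) (<⇒≱ l))
  atoms : ∀ y → P ≤ toℕ y → Atom S E (lookup (F ++ G) y) (((σ ∘ suc) ⧺ τ) y)
  atoms = ++-case _
    (λ y l → subst₂ (Atom S E) (sym (lookup-++ˡ F G y)) (sym (⧺-↑ˡ (σ ∘ suc) τ y))
      (a y (subst (P ≤_) (toℕ-↑ˡ y M) l)))
    (λ y l → subst₂ (Atom S E) (sym (lookup-++ʳ F G y)) (sym (⧺-↑ʳ (σ ∘ suc) τ y)) (c y))

-- The box was opened on an empty frame, so every declared variable of the slice is a hole and hence
-- linear with a type, as the premise of (§ i) demands.
open-box : {S′ : Stack n k} {E′ : Frame k n} {f : Slot k} → S′ ≡ S ▸ E ⟨ Ty.id ⟩ → E′ ≡ const absent →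
           Atom S′ E′ f u → ∃[ f′ ] f ⇝§ f′ × Let S E f′ u
open-box _ _ none = absent , absent , none
open-box _ refl (linear-var ())
open-box _ refl (nonlinear-var ())
open-box refl _ (hole {B = B} h) =
  linear [ B ]§ , subst (λ A → linear (type A) ⇝§ linear [ B ]§) (sym (TL.id-vanishes B)) discharge , hole h

slice-§-i : Slice (S ▸ E ⟨ Ty.id ⟩) (const absent) t A → Slice S E t (§ A)
slice-§-i {S = S} {E = E} (slice {N = N} F σ {t} d q a) =
  -- All variables are pending: `P = N` leaves none to be an atom.
  slice-let N F§ σ (§-i d ⇝)
    (λ {y} e → q (⇝-linear (Pointwise.lookup ⇝ y) e .proj₂)) ≤-refl
    (λ y _ → subst (λ f → Let S E f (σ y)) (sym (lookup∘tabulate _ y)) (boxes y .proj₂ .proj₂))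
    (λ y l → contradiction l (<⇒≱ (toℕ<n y)))
  where
  boxes : ∀ y → ∃[ f ] lookup F y ⇝§ f × Let S E f (σ y)
  boxes y = open-box refl refl (a y)
  F§ : Env _ N
  F§ = tabulate (proj₁ ∘ boxes)
  ⇝ : Pointwise _⇝§_ F F§
  ⇝ = subst (λ G → Pointwise _⇝§_ G F§) (tabulate∘lookup F)
    (Pointwise.tabulate⁺ (λ y → boxes y .proj₂ .proj₁))

⊩⇒slice : S ∣ E ⊩ t ∶ A → Slice S E t A
⊩⇒slice (var-i p)   = slice-var p
⊩⇒slice (⊸-i d q)   = slice-⊸-i (⊩⇒slice d) q
⊩⇒slice (⊸-e d e)   = slice-⊸-e (⊩⇒slice d) (⊩⇒slice e)
⊩⇒slice (⇒-i d)     = slice-⇒-i (⊩⇒slice d)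
⊩⇒slice (⇒-e d e q) = slice-⇒-e (⊩⇒slice d) (⊩⇒slice e) q
⊩⇒slice (§-i d)     = slice-§-i (⊩⇒slice d)
⊩⇒slice (§-e d)     = slice-hole (⊩⇒slice d)
⊩⇒slice (∀-i d)     = slice-∀-i (⊩⇒slice d)
⊩⇒slice (∀-e d)     = slice-∀-e (⊩⇒slice d)

atom-ε : {f : Slot k} → Atom ε E f u → f ≢ absent → ∃[ x ] u ≡ var x × E x ≡ f
atom-ε none l                      = contradiction refl l
atom-ε (linear-var {x = x} e) l    = x , refl , e
atom-ε (nonlinear-var {x = x} e) l = x , refl , e

-- At level 0 there are no holes, so every declared variable stands for a variable of `E`; `Affine`
-- and `Used` together keep the linear ones apart.
slice⇒⊢ : {E : Env k n} → Slice ε (lookup E) t A → Affine t (lookup E) → E ⊢ t ∶ A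
slice⇒⊢ {E = E} (slice F σ {t} d q a) affine = collapse d fits injective
  where
  fits : Fits F σ E
  fits {y} l = atom-ε (a y) l
  injective : LinearInjective F σ
  injective {y} {y′} {x} e e′ p p′ with y ≟ y′
  ... | yes y≡y′ = y≡y′
  ... | no  y≢y′ = contradiction
    (used-twice σ t (δ x) y≢y′ (q e) (q e′) (weight p) (weight p′))
    (<⇒≱ (s≤s (affine linear-x)))
    where
    weight : ∀ {y} → σ y ≡ var x → 1 ≤ ‖ σ y ‖ (δ x)
    weight p rewrite p = ≤-reflexive (sym (δ-refl x))
    linear-x : lookup E x ≡ linear _
    linear-x with x′ , p₁ , e₁ ← atom-ε (a y) (≢absent e λ ()) with refl ← trans (sym p) p₁ = trans e₁ e

theorem12 : ∀ {k n : ℕ} (t₀ t₁ : Term n) (E : Env k n) (A : Type k) → E ⊢ t₀ ∶ A → t₀ ⟶ t₁ → E ⊢ t₁ ∶ A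
theorem12 t₀ t₁ E A d r with d₀ , affine ← ⊢⇒⊩ d with d₁ , shrink ← ⊩-⟶ d₀ r =
  slice⇒⊢ (⊩⇒slice d₁) λ {x} e → ≤-trans
    -- As `x` is linear, `δ x` is zero on all nonlinear variables, so the reduction does not
    -- increase the occurrences of `x`.
    (shrink (δ x) (λ {y} e′ → δ-≢ {x = x} {y} λ { refl → case trans (sym e) e′ of λ () }))
    (affine e)
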